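{- Let $E$ be a finite set of well-formed closed sentences each of which is $\omega$-true (in particular, $E$ may be a single well-formed $\omega$-true sentence). Then the extension of OGA by $E$ yields no contradiction: there is no term $c$ such that both $E\vdash c$ and $E\vdash\neg c$ are derivable in OGA.
   Context: **Syntax.** Terms: $t::=v_i\mid\bot\mid\mathbf 0\mid\mathbf S t\mid t=t\mid\neg t\mid t\lor t\mid\lambda t\mid t\cdot t\mid\mathcal R\mid\mathcal A$ ($v_i$, $i\in\mathbb N$, de Bruijn variables; $\lambda$ is the only binder; application associates to the left). A term is well-formed (wf) if generated by this grammar. $\bot$ is a divergent constant, $\mathcal R$ the primitive recursor, $\mathcal A$ the universal quantifier. Abbreviations: $t\,\mathsf N$ is $t=t$; $t\,\mathsf B$ is $t\lor\neg t$; $t\ne u$ is $\neg(t=u)$; $t\land u$ is $\neg(\neg t\lor\neg u)$; $t\to u$ is $\neg t\lor u$; $\underline n=\mathbf S^n\mathbf 0$. $\uparrow$ shifts all free indices up by one; $b[t]$ is the $\beta$-instance substituting $t$ for the outermost bound variable of $b$; $[v\mapsto s]$ is capture-avoiding substitution for a free variable; $\mathrm{fv}$ is the set of free variables. **Head steps** $\triangleright$: $(\lambda b)\cdot t\triangleright b[t]$; $\mathcal R\cdot g\cdot h\cdot\mathbf 0\triangleright g$; $\mathcal R\cdot g\cdot h\cdot(\mathbf S\underline n)\triangleright h\cdot\underline n\cdot(\mathcal R\cdot g\cdot h\cdot\underline n)$; if $t\triangleright t'$ then $t\cdot u\triangleright t'\cdot u$. **Rules.** Judgments are $\Gamma\vdash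 c$, $\Gamma$ a finite set of wf terms, $c$ a wf term (all terms in rules are wf). A proof is a finite list of judgments each following from earlier entries by one rule; $\Gamma\vdash c$ is derivable if it occurs in a proof. Rules ("$\Rightarrow$" from premises to conclusion, "$\Leftrightarrow$" both directions; $\Gamma$ is the context of a judgment when none is shown): $\Gamma,c\vdash c$; $\Gamma\vdash c\Rightarrow\Gamma,a\vdash c$; $\Gamma\vdash a$ and $\Gamma,a\vdash c\Rightarrow\Gamma\vdash c$; $\Gamma\vdash c\Rightarrow[v\mapsto s]\Gamma\vdash[v\mapsto s]c$; $\vdash a\Leftrightarrow\ \vdash a=\underline1$; $\vdash\neg a\Leftrightarrow\ \vdash a=\underline0$; $\vdash\neg a,\ \vdash a\Rightarrow\ \vdash c$; $\vdash a\Leftrightarrow\ \vdash\neg\neg a$; $\vdash a\Rightarrow\ \vdash a\lor b$; $\vdash b\Rightarrow\ \vdash a\lor b$; $\vdash\neg a,\ \vdash\neg b\Rightarrow\ \vdash\neg(a\lor b)$; $\vdash a\lor b,\ \Gamma,a\vdash c,\ \Gamma,b\vdash c\Rightarrow\ \vdash c$; $\vdash\neg(a\lor b)\Rightarrow\ \vdash\neg a$; $\vdash\neg(a\lor b)\Rightarrow\ \vdash\neg b$; $\vdash a\,\mathsf N\Leftrightarrow\ \vdash a=a$; $\vdash a=b\Rightarrow\ \vdash b=a$; $\vdash a=b,\ \vdash[v\mapsto a]p\Rightarrow\ \vdash[v\mapsto b]p$; $\vdash a\ne b\Rightarrow\ \vdash b\ne a$; $\vdash a\,\mathsf N,\ \vdash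 b\,\mathsf N\Rightarrow\ \vdash(a=b)\,\mathsf B$; $\vdash(a=b)\,\mathsf B\Rightarrow\ \vdash(a\,\mathsf N)\land(b\,\mathsf N)$; $\vdash\mathbf 0\,\mathsf N$; $\vdash a\,\mathsf N\Leftrightarrow\ \vdash(\mathbf S a)\,\mathsf N$; $\vdash a\,\mathsf N\Rightarrow\ \vdash\mathbf S a\ne\mathbf 0$; $\vdash a\ne b\Leftrightarrow\ \vdash\mathbf S a\ne\mathbf S b$; $\vdash\mathbf S a=\mathbf S b\Rightarrow\ \vdash a=b$; $\vdash\bot\,\mathsf N\Rightarrow\ \vdash p$; induction: $\vdash[v_i\mapsto\mathbf 0]c$, $\ v_i\,\mathsf N,c,\Gamma\vdash[v_i\mapsto\mathbf S v_i]c$, $\ \vdash a\,\mathsf N\Rightarrow\ \vdash[v_i\mapsto a]c$ if $v_i\notin\mathrm{fv}(\Gamma)$; conversion, for $c\triangleright c'$: $\vdash c'\Rightarrow\ \vdash c$; $\vdash c\Rightarrow\ \vdash c'$; $\vdash\neg c\Rightarrow\ \vdash\neg c'$; $\vdash c'\,\mathsf N\Rightarrow\ \vdash c=c'$; $\vdash m\,\mathsf N,\ \vdash(h\cdot m\cdot(\mathcal R\cdot g\cdot h\cdot m))\,\mathsf N\Rightarrow\ \vdash\mathcal R\cdot g\cdot h\cdot(\mathbf S m)=h\cdot m\cdot(\mathcal R\cdot g\cdot h\cdot m)$; $v_0\,\mathsf N,\uparrow\Gamma\vdash\uparrow f\cdot v_0\Rightarrow\Gamma\vdash\mathcal A\cdot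 f$; $\vdash\mathcal A\cdot f,\ \vdash a\,\mathsf N\Rightarrow\ \vdash f\cdot a$; $\vdash\neg(f\cdot a),\ \vdash a\,\mathsf N\Rightarrow\ \vdash\neg(\mathcal A\cdot f)$; $\Gamma\vdash\neg(\mathcal A\cdot f)$ and $v_0\,\mathsf N,\neg(\uparrow f\cdot v_0),\uparrow\Gamma\vdash\uparrow c\Rightarrow\Gamma\vdash c$. These are the rules of RGA. OGA has these and the rule ATI: $\Gamma\vdash\mathcal A\cdot(\lambda((\uparrow u\cdot v_0)\,\mathsf B))\Rightarrow\Gamma\vdash(\mathcal A\cdot u)\,\mathsf B$. Derivability in the extension of OGA by $E$ means OGA-derivability from the hypotheses $E$. **$\omega$-truth.** Let $\Downarrow$ be the least relation between closed terms and naturals such that: $\mathbf 0\Downarrow0$; $t\Downarrow n$ implies $\mathbf S t\Downarrow n+1$; if $t\Downarrow m$, $u\Downarrow n$ then $(t=u)\Downarrow1$ when $m=n$ and $(t=u)\Downarrow0$ when $m\ne n$; $t\Downarrow1$ implies $\neg t\Downarrow0$, and $t\Downarrow0$ implies $\neg t\Downarrow1$; $t\lor u\Downarrow1$ if $t\Downarrow1$ or $u\Downarrow1$, and $t\lor u\Downarrow0$ if $t\Downarrow0$ and $u\Downarrow0$; for any finite list of arguments $\vec s$: $b[t]\cdot\vec s\Downarrow n$ implies $(\lambda b)\cdot t\cdot\vec s\Downarrow n$; if $a\Downarrow0$ and $g\cdot\vec s\Downarrow n$ then $\mathcal R\cdot g\cdot h\cdot a\cdot\vec s\Downarrow n$;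 if $a\Downarrow k+1$ and $h\cdot\underline k\cdot(\mathcal R\cdot g\cdot h\cdot\underline k)\cdot\vec s\Downarrow n$ then $\mathcal R\cdot g\cdot h\cdot a\cdot\vec s\Downarrow n$; $\mathcal A\cdot f\Downarrow1$ if $f\cdot\underline k\Downarrow1$ for all $k\in\mathbb N$; $\mathcal A\cdot f\Downarrow0$ if $f\cdot\underline k\Downarrow0$ for some $k$. A closed term $t$ is $\omega$-true if $t\Downarrow1$. -}

module Defs where

open import Data.Empty using (⊥)
open import Data.List.Base using (List; []; _∷_; map; foldl)
open import Data.List.Membership.Propositional using (_∈_)
open import Data.List.Relation.Binary.BagAndSetEquality using (_∼[_]_; set)
open import Data.List.Relation.Unary.All using (All)
open import Data.Nat.Base using (ℕ; zero; suc)
open import Data.Nat.Properties using (_≟_)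
open import Data.Product.Base using (∃-syntax; _×_)
open import Data.Sum.Base using (_⊎_)
open import Relation.Binary.PropositionalEquality.Core using (_≡_; _≢_)
open import Relation.Nullary.Decidable.Core using (yes; no)
open import Relation.Nullary.Negation.Core using (¬_)

infix  4 _⊢_ _▷_ _⇓_ _∈fv_
infixr 6 _∨ᵗ_
infixr 7 _∧ᵗ_
infix  8 _=ᵗ_ _≠ᵗ_
infix  9 _𝖭 _𝖡
infixl 10 _·_ _·*_

-- Terms, with de Bruijn indices.  Every inhabitant is well-formed.
data Term : Set where
  var  : ℕ → Term
  ⊥ᵗ   : Term
  𝟎    : Term
  𝐒    : Term → Term
  _=ᵗ_ : Term → Term → Term
  ¬ᵗ   : Term → Term
  _∨ᵗ_ : Term → Term → Term
  ƛ    : Term → Term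
  _·_  : Term → Term → Term
  ℛ    : Term
  𝒜    : Term

_𝖭 : Term → Term
t 𝖭 = t =ᵗ t

_𝖡 : Term → Term
t 𝖡 = t ∨ᵗ ¬ᵗ t

_≠ᵗ_ : Term → Term → Term
t ≠ᵗ u = ¬ᵗ (t =ᵗ u)

_∧ᵗ_ : Term → Term → Term
t ∧ᵗ u = ¬ᵗ (¬ᵗ t ∨ᵗ ¬ᵗ u)

num : ℕ → Term
num zero    = 𝟎
num (suc n) = 𝐒 (num n)

_·*_ : Term → List Term → Term
t ·* ss = foldl _·_ t ss

_∈fv_ : ℕ → Term → Set
i ∈fv var j    = i ≡ j
i ∈fv ⊥ᵗ       = ⊥
i ∈fv 𝟎        = ⊥
i ∈fv 𝐒 t      = i ∈fv t
i ∈fv (t =ᵗ u) = i ∈fv t ⊎ i ∈fv u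
i ∈fv ¬ᵗ t     = i ∈fv t
i ∈fv (t ∨ᵗ u) = i ∈fv t ⊎ i ∈fv u
i ∈fv ƛ b      = suc i ∈fv b
i ∈fv (t · u)  = i ∈fv t ⊎ i ∈fv u
i ∈fv ℛ        = ⊥
i ∈fv 𝒜        = ⊥

Closed : Term → Set
Closed t = ∀ i → ¬ (i ∈fv t)

extᵣ : (ℕ → ℕ) → ℕ → ℕ
extᵣ ρ zero    = zero
extᵣ ρ (suc i) = suc (ρ i)

rename : (ℕ → ℕ) → Term → Term
rename ρ (var i)  = var (ρ i)
rename ρ ⊥ᵗ       = ⊥ᵗ
rename ρ 𝟎        = 𝟎
rename ρ (𝐒 t)    = 𝐒 (rename ρ t)
rename ρ (t =ᵗ u) = rename ρ t =ᵗ rename ρ u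
rename ρ (¬ᵗ t)   = ¬ᵗ (rename ρ t)
rename ρ (t ∨ᵗ u) = rename ρ t ∨ᵗ rename ρ u
rename ρ (ƛ b)    = ƛ (rename (extᵣ ρ) b)
rename ρ (t · u)  = rename ρ t · rename ρ u
rename ρ ℛ        = ℛ
rename ρ 𝒜        = 𝒜

↑ : Term → Term
↑ = rename suc

extₛ : (ℕ → Term) → ℕ → Term
extₛ σ zero    = var zero
extₛ σ (suc i) = ↑ (σ i)

subst : (ℕ → Term) → Term → Term
subst σ (var i)  = σ i
subst σ ⊥ᵗ       = ⊥ᵗ
subst σ 𝟎        = 𝟎
subst σ (𝐒 t)    = 𝐒 (subst σ t)
subst σ (t =ᵗ u) = subst σ t =ᵗ subst σ u
subst σ (¬ᵗ t)   = ¬ᵗ (subst σ t)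
subst σ (t ∨ᵗ u) = subst σ t ∨ᵗ subst σ u
subst σ (ƛ b)    = ƛ (subst (extₛ σ) b)
subst σ (t · u)  = subst σ t · subst σ u
subst σ ℛ        = ℛ
subst σ 𝒜        = 𝒜

β-sub : Term → ℕ → Term
β-sub t zero    = t
β-sub t (suc i) = var i

-- The β-instance: index 0 is replaced and the other free indices drop by one.
_⟨_⟩ : Term → Term → Term
b ⟨ t ⟩ = subst (β-sub t) b

single : ℕ → Term → ℕ → Term
single i s j with i ≟ j
... | yes _ = s
... | no  _ = var j

-- Substitution for a free variable: unlike in b ⟨ t ⟩, no other index moves.
[_↦_]_ : ℕ → Term → Term → Term
[ i ↦ s ] t = subst (single i s) t

data _▷_ : Term → Term → Set where
  ▷-β   : ∀ {b t} → ƛ b · t ▷ b ⟨ t ⟩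
  ▷-ℛ0  : ∀ {g h} → ℛ · g · h · 𝟎 ▷ g
  ▷-ℛS  : ∀ {g h} n →
          ℛ · g · h · 𝐒 (num n) ▷ h · num n · (ℛ · g · h · num n)
  ▷-app : ∀ {t t′ u} → t ▷ t′ → t · u ▷ t′ · u

-- Contexts are finite sets, represented by lists that are only ever used up
-- to set equality (see `same` below).
Context : Set
Context = List Term

data Judgment : Set where
  _⊢_ : Context → Term → Judgment

-- RGA ps j: the judgment j follows from the premises ps by one rule of RGA.
-- The suffixes ⁺ and ⁻ mark the two directions of a two-way rule.
data RGA : List Judgment → Judgment → Set where
  hyp    : ∀ {Γ c} → RGA [] (c ∷ Γ ⊢ c)
  weaken : ∀ {Γ a c} → RGA ((Γ ⊢ c) ∷ []) (a ∷ Γ ⊢ c)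
  cut    : ∀ {Γ a c} → RGA ((Γ ⊢ a) ∷ (a ∷ Γ ⊢ c) ∷ []) (Γ ⊢ c)
  inst   : ∀ {Γ c} i s →
           RGA ((Γ ⊢ c) ∷ []) (map ([ i ↦ s ]_) Γ ⊢ [ i ↦ s ] c)

  true⁺  : ∀ {Γ a} → RGA ((Γ ⊢ a) ∷ []) (Γ ⊢ a =ᵗ num 1)
  true⁻  : ∀ {Γ a} → RGA ((Γ ⊢ a =ᵗ num 1) ∷ []) (Γ ⊢ a)
  false⁺ : ∀ {Γ a} → RGA ((Γ ⊢ ¬ᵗ a) ∷ []) (Γ ⊢ a =ᵗ num 0)
  false⁻ : ∀ {Γ a} → RGA ((Γ ⊢ a =ᵗ num 0) ∷ []) (Γ ⊢ ¬ᵗ a)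

  explosion : ∀ {Γ a c} → RGA ((Γ ⊢ ¬ᵗ a) ∷ (Γ ⊢ a) ∷ []) (Γ ⊢ c)
  ¬¬⁺       : ∀ {Γ a} → RGA ((Γ ⊢ a) ∷ []) (Γ ⊢ ¬ᵗ (¬ᵗ a))
  ¬¬⁻       : ∀ {Γ a} → RGA ((Γ ⊢ ¬ᵗ (¬ᵗ a)) ∷ []) (Γ ⊢ a)

  ∨-introˡ  : ∀ {Γ a b} → RGA ((Γ ⊢ a) ∷ []) (Γ ⊢ a ∨ᵗ b)
  ∨-introʳ  : ∀ {Γ a b} → RGA ((Γ ⊢ b) ∷ []) (Γ ⊢ a ∨ᵗ b)
  ¬∨-intro  : ∀ {Γ a b} →
              RGA ((Γ ⊢ ¬ᵗ a) ∷ (Γ ⊢ ¬ᵗ b) ∷ []) (Γ ⊢ ¬ᵗ (a ∨ᵗ b))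
  ∨-elim    : ∀ {Γ a b c} →
              RGA ((Γ ⊢ a ∨ᵗ b) ∷ (a ∷ Γ ⊢ c) ∷ (b ∷ Γ ⊢ c) ∷ []) (Γ ⊢ c)
  ¬∨-elimˡ  : ∀ {Γ a b} → RGA ((Γ ⊢ ¬ᵗ (a ∨ᵗ b)) ∷ []) (Γ ⊢ ¬ᵗ a)
  ¬∨-elimʳ  : ∀ {Γ a b} → RGA ((Γ ⊢ ¬ᵗ (a ∨ᵗ b)) ∷ []) (Γ ⊢ ¬ᵗ b)

  𝖭-def⁺   : ∀ {Γ a} → RGA ((Γ ⊢ a 𝖭) ∷ []) (Γ ⊢ a =ᵗ a)
  𝖭-def⁻   : ∀ {Γ a} → RGA ((Γ ⊢ a =ᵗ a) ∷ []) (Γ ⊢ a 𝖭)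
  =-sym    : ∀ {Γ a b} → RGA ((Γ ⊢ a =ᵗ b) ∷ []) (Γ ⊢ b =ᵗ a)
  =-subst  : ∀ {Γ a b} i p →
             RGA ((Γ ⊢ a =ᵗ b) ∷ (Γ ⊢ [ i ↦ a ] p) ∷ []) (Γ ⊢ [ i ↦ b ] p)
  ≠-sym    : ∀ {Γ a b} → RGA ((Γ ⊢ a ≠ᵗ b) ∷ []) (Γ ⊢ b ≠ᵗ a)
  =-bool   : ∀ {Γ a b} →
             RGA ((Γ ⊢ a 𝖭) ∷ (Γ ⊢ b 𝖭) ∷ []) (Γ ⊢ (a =ᵗ b) 𝖡)
  =-bool⁻¹ : ∀ {Γ a b} →
             RGA ((Γ ⊢ (a =ᵗ b) 𝖡) ∷ []) (Γ ⊢ (a 𝖭) ∧ᵗ (b 𝖭))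

  𝟎-nat  : ∀ {Γ} → RGA [] (Γ ⊢ 𝟎 𝖭)
  𝐒-nat⁺ : ∀ {Γ a} → RGA ((Γ ⊢ a 𝖭) ∷ []) (Γ ⊢ (𝐒 a) 𝖭)
  𝐒-nat⁻ : ∀ {Γ a} → RGA ((Γ ⊢ (𝐒 a) 𝖭) ∷ []) (Γ ⊢ a 𝖭)
  𝐒≠𝟎    : ∀ {Γ a} → RGA ((Γ ⊢ a 𝖭) ∷ []) (Γ ⊢ 𝐒 a ≠ᵗ 𝟎)
  𝐒-≠⁺   : ∀ {Γ a b} → RGA ((Γ ⊢ a ≠ᵗ b) ∷ []) (Γ ⊢ 𝐒 a ≠ᵗ 𝐒 b)
  𝐒-≠⁻   : ∀ {Γ a b} → RGA ((Γ ⊢ 𝐒 a ≠ᵗ 𝐒 b) ∷ []) (Γ ⊢ a ≠ᵗ b)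
  𝐒-inj  : ∀ {Γ a b} → RGA ((Γ ⊢ 𝐒 a =ᵗ 𝐒 b) ∷ []) (Γ ⊢ a =ᵗ b)
  ⊥-nat  : ∀ {Γ p} → RGA ((Γ ⊢ ⊥ᵗ 𝖭) ∷ []) (Γ ⊢ p)

  induction : ∀ {Γ a c} i → All (λ g → ¬ (i ∈fv g)) Γ →
              RGA ((Γ ⊢ [ i ↦ 𝟎 ] c) ∷
                   (var i 𝖭 ∷ c ∷ Γ ⊢ [ i ↦ 𝐒 (var i) ] c) ∷
                   (Γ ⊢ a 𝖭) ∷ [])
                  (Γ ⊢ [ i ↦ a ] c)

  conv-expand : ∀ {Γ c c′} → c ▷ c′ → RGA ((Γ ⊢ c′) ∷ []) (Γ ⊢ c)
  conv-reduce : ∀ {Γ c c′} → c ▷ c′ → RGA ((Γ ⊢ c) ∷ []) (Γ ⊢ c′)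
  conv-¬      : ∀ {Γ c c′} → c ▷ c′ → RGA ((Γ ⊢ ¬ᵗ c) ∷ []) (Γ ⊢ ¬ᵗ c′)
  conv-=      : ∀ {Γ c c′} → c ▷ c′ → RGA ((Γ ⊢ c′ 𝖭) ∷ []) (Γ ⊢ c =ᵗ c′)

  ℛ-step : ∀ {Γ g h m} →
           RGA ((Γ ⊢ m 𝖭) ∷ (Γ ⊢ (h · m · (ℛ · g · h · m)) 𝖭) ∷ [])
               (Γ ⊢ ℛ · g · h · 𝐒 m =ᵗ h · m · (ℛ · g · h · m))

  ∀-intro  : ∀ {Γ f} →
             RGA ((var 0 𝖭 ∷ map ↑ Γ ⊢ ↑ f · var 0) ∷ []) (Γ ⊢ 𝒜 · f)
  ∀-elim   : ∀ {Γ f a} →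
             RGA ((Γ ⊢ 𝒜 · f) ∷ (Γ ⊢ a 𝖭) ∷ []) (Γ ⊢ f · a)
  ¬∀-intro : ∀ {Γ f a} →
             RGA ((Γ ⊢ ¬ᵗ (f · a)) ∷ (Γ ⊢ a 𝖭) ∷ []) (Γ ⊢ ¬ᵗ (𝒜 · f))
  ¬∀-elim  : ∀ {Γ f c} →
             RGA ((Γ ⊢ ¬ᵗ (𝒜 · f)) ∷
                  (var 0 𝖭 ∷ ¬ᵗ (↑ f · var 0) ∷ map ↑ Γ ⊢ ↑ c) ∷ [])
                 (Γ ⊢ c)

data OGA : List Judgment → Judgment → Set where
  rga : ∀ {ps j} → RGA ps j → OGA ps j
  ATI : ∀ {Γ u} →
        OGA ((Γ ⊢ 𝒜 · ƛ ((↑ u · var 0) 𝖡)) ∷ []) (Γ ⊢ (𝒜 · u) 𝖡)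

-- Proofs over a set of rules, latest entry first.  `same` is not a rule of
-- the calculus: it re-lists a judgment under another list for the same
-- context set.
data Proof (Rule : List Judgment → Judgment → Set) : List Judgment → Set where
  []   : Proof Rule []
  step : ∀ {π ps j} → Proof Rule π → Rule ps j → All (_∈ π) ps →
         Proof Rule (j ∷ π)
  same : ∀ {π Γ Δ c} → Proof Rule π → (Γ ⊢ c) ∈ π → Γ ∼[ set ] Δ →
         Proof Rule ((Δ ⊢ c) ∷ π)

Derivable : (List Judgment → Judgment → Set) → Judgment → Set
Derivable Rule j = ∃[ π ] (Proof Rule π × j ∈ π)

-- Stated on all terms, but the premises of a rule with closed conclusion are
-- closed, so on closed terms this is the least relation between closed terms
-- and naturals satisfying the clauses.
data _⇓_ : Term → ℕ → Set where
  ⇓-𝟎    : 𝟎 ⇓ 0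
  ⇓-𝐒    : ∀ {t n} → t ⇓ n → 𝐒 t ⇓ suc n
  ⇓-=    : ∀ {t u m n} → t ⇓ m → u ⇓ n → m ≡ n → (t =ᵗ u) ⇓ 1
  ⇓-≠    : ∀ {t u m n} → t ⇓ m → u ⇓ n → m ≢ n → (t =ᵗ u) ⇓ 0
  ⇓-¬₁   : ∀ {t} → t ⇓ 1 → ¬ᵗ t ⇓ 0
  ⇓-¬₀   : ∀ {t} → t ⇓ 0 → ¬ᵗ t ⇓ 1
  ⇓-∨₁ˡ  : ∀ {t u} → t ⇓ 1 → (t ∨ᵗ u) ⇓ 1
  ⇓-∨₁ʳ  : ∀ {t u} → u ⇓ 1 → (t ∨ᵗ u) ⇓ 1
  ⇓-∨₀   : ∀ {t u} → t ⇓ 0 → u ⇓ 0 → (t ∨ᵗ u) ⇓ 0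
  ⇓-β    : ∀ {b t n} ss → b ⟨ t ⟩ ·* ss ⇓ n → ƛ b · t ·* ss ⇓ n
  ⇓-ℛ0   : ∀ {g h a n} ss → a ⇓ 0 → g ·* ss ⇓ n → ℛ · g · h · a ·* ss ⇓ n
  ⇓-ℛS   : ∀ {g h a k n} ss → a ⇓ suc k →
           h · num k · (ℛ · g · h · num k) ·* ss ⇓ n →
           ℛ · g · h · a ·* ss ⇓ n
  ⇓-𝒜₁   : ∀ {f} → (∀ k → f · num k ⇓ 1) → 𝒜 · f ⇓ 1
  ⇓-𝒜₀   : ∀ {f} k → f · num k ⇓ 0 → 𝒜 · f ⇓ 0

ω-True : Term → Set
ω-True t = Closed t × t ⇓ 1

{-# OPTIONS --safe #-}
module Submission where

-- Validity in the ω-model cannot be read constructively as "has value 1": ATI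
-- needs a case split on ∃k (u·k ⇓ 0), and ¬¬ does not commute with the premises
-- "for all k" of an inductively defined ⇓.  Instead, truth is stratified by
-- well-founded stages: a stage fixes which terms 𝒜·f already count as true, by
-- recursion on the stage with a ¬¬ in front of every instance, so that truth at
-- a stage is ¬¬-stable.  A judgment is valid if every stage α has a stage β
-- such that, for all substitutions σ, truth of Γσ at α gives truth of cσ at β.
-- All rules preserve this (only countable suprema of stages are needed), values
-- are unique across stages, and every ω-true sentence is true at some stage.

open import Defs
open import Data.Empty using (⊥)
open import Data.List.Base using (List; []; _∷_; map)
open import Data.List.Relation.Unary.All using (All; []; _∷_)
import Data.List.Relation.Unary.All as All
import Data.List.Relation.Unary.All.Properties as All
open import Data.Nat.Base using (ℕ; zero; suc)
open import Data.Nat.Properties using (_≟_; suc-injective)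
open import Data.Product.Base using (Σ; ∃-syntax; _×_; _,_; proj₁; proj₂)
open import Data.Sum.Base using (_⊎_; inj₁; inj₂; [_,_]′)
open import Data.Unit.Base using (⊤; tt)
open import Effect.Monad using (RawMonad)
open import Function.Base using (_∘_; const; id)
open import Function.Bundles using (Equivalence)
open import Level using (0ℓ)
open import Relation.Binary.PropositionalEquality.Core
  using (_≡_; _≢_; refl; sym; trans; cong; cong₂) renaming (subst to transport)
open import Relation.Binary.PropositionalEquality.Properties using (module ≡-Reasoning)
open import Relation.Nullary.Decidable.Core using (yes; no; decidable-stable; ¬¬-excluded-middle)
open import Relation.Nullary.Negation using (¬_; contradiction; ¬¬-Monad)

open ≡-Reasoning
open RawMonad {f = 0ℓ} ¬¬-Monad using (_>>=_; return; _<$>_)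

-- Substitution calculus

extₛ-cong : ∀ {σ τ} t → (∀ i → i ∈fv ƛ t → σ i ≡ τ i) → ∀ i → i ∈fv t → extₛ σ i ≡ extₛ τ i
extₛ-cong t eq zero    _ = refl
extₛ-cong t eq (suc i) p = cong ↑ (eq i p)

-- Agreement is asked only at free indices, because the induction rule overwrites an index that is
-- fresh for the context.
subst-cong-fv : ∀ {σ τ} t → (∀ i → i ∈fv t → σ i ≡ τ i) → subst σ t ≡ subst τ t
subst-cong-fv (var i)  eq = eq i refl
subst-cong-fv ⊥ᵗ       eq = refl
subst-cong-fv 𝟎        eq = refl
subst-cong-fv (𝐒 t)    eq = cong 𝐒 (subst-cong-fv t eq)
subst-cong-fv (t =ᵗ u) eq =
  cong₂ _=ᵗ_ (subst-cong-fv t λ i → eq i ∘ inj₁) (subst-cong-fv u λ i → eq i ∘ inj₂)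
subst-cong-fv (¬ᵗ t)   eq = cong ¬ᵗ (subst-cong-fv t eq)
subst-cong-fv (t ∨ᵗ u) eq =
  cong₂ _∨ᵗ_ (subst-cong-fv t λ i → eq i ∘ inj₁) (subst-cong-fv u λ i → eq i ∘ inj₂)
subst-cong-fv (ƛ t)    eq = cong ƛ (subst-cong-fv t (extₛ-cong t eq))
subst-cong-fv (t · u)  eq =
  cong₂ _·_ (subst-cong-fv t λ i → eq i ∘ inj₁) (subst-cong-fv u λ i → eq i ∘ inj₂)
subst-cong-fv ℛ        eq = refl
subst-cong-fv 𝒜        eq = refl

subst-cong : ∀ {σ τ} → (∀ i → σ i ≡ τ i) → ∀ t → subst σ t ≡ subst τ t
subst-cong eq t = subst-cong-fv t λ i _ → eq i

rename-as-subst : ∀ ρ t → rename ρ t ≡ subst (var ∘ ρ) t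
rename-as-subst ρ (var i)  = refl
rename-as-subst ρ ⊥ᵗ       = refl
rename-as-subst ρ 𝟎        = refl
rename-as-subst ρ (𝐒 t)    = cong 𝐒 (rename-as-subst ρ t)
rename-as-subst ρ (t =ᵗ u) = cong₂ _=ᵗ_ (rename-as-subst ρ t) (rename-as-subst ρ u)
rename-as-subst ρ (¬ᵗ t)   = cong ¬ᵗ (rename-as-subst ρ t)
rename-as-subst ρ (t ∨ᵗ u) = cong₂ _∨ᵗ_ (rename-as-subst ρ t) (rename-as-subst ρ u)
rename-as-subst ρ (ƛ t)    = cong ƛ (trans (rename-as-subst (extᵣ ρ) t) (subst-cong ext t))
  where
  ext : ∀ i → var (extᵣ ρ i) ≡ extₛ (var ∘ ρ) i
  ext zero    = refl
  ext (suc i) = refl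
rename-as-subst ρ (t · u)  = cong₂ _·_ (rename-as-subst ρ t) (rename-as-subst ρ u)
rename-as-subst ρ ℛ        = refl
rename-as-subst ρ 𝒜        = refl

subst-rename : ∀ σ ρ t → subst σ (rename ρ t) ≡ subst (σ ∘ ρ) t
subst-rename σ ρ (var i)  = refl
subst-rename σ ρ ⊥ᵗ       = refl
subst-rename σ ρ 𝟎        = refl
subst-rename σ ρ (𝐒 t)    = cong 𝐒 (subst-rename σ ρ t)
subst-rename σ ρ (t =ᵗ u) = cong₂ _=ᵗ_ (subst-rename σ ρ t) (subst-rename σ ρ u)
subst-rename σ ρ (¬ᵗ t)   = cong ¬ᵗ (subst-rename σ ρ t)
subst-rename σ ρ (t ∨ᵗ u) = cong₂ _∨ᵗ_ (subst-rename σ ρ t) (subst-rename σ ρ u)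
subst-rename σ ρ (ƛ t)    = cong ƛ (trans (subst-rename (extₛ σ) (extᵣ ρ) t) (subst-cong ext t))
  where
  ext : ∀ i → extₛ σ (extᵣ ρ i) ≡ extₛ (σ ∘ ρ) i
  ext zero    = refl
  ext (suc i) = refl
subst-rename σ ρ (t · u)  = cong₂ _·_ (subst-rename σ ρ t) (subst-rename σ ρ u)
subst-rename σ ρ ℛ        = refl
subst-rename σ ρ 𝒜        = refl

rename-↑ : ∀ ρ t → rename (extᵣ ρ) (↑ t) ≡ ↑ (rename ρ t)
rename-↑ ρ t = begin
  rename (extᵣ ρ) (↑ t)        ≡⟨ rename-as-subst (extᵣ ρ) (↑ t) ⟩
  subst (var ∘ extᵣ ρ) (↑ t)   ≡⟨ subst-rename _ suc t ⟩
  subst (var ∘ suc ∘ ρ) t      ≡⟨ subst-rename _ ρ t ⟨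
  subst (var ∘ suc) (rename ρ t) ≡⟨ rename-as-subst suc (rename ρ t) ⟨
  ↑ (rename ρ t)               ∎

rename-subst : ∀ ρ σ t → rename ρ (subst σ t) ≡ subst (rename ρ ∘ σ) t
rename-subst ρ σ (var i)  = refl
rename-subst ρ σ ⊥ᵗ       = refl
rename-subst ρ σ 𝟎        = refl
rename-subst ρ σ (𝐒 t)    = cong 𝐒 (rename-subst ρ σ t)
rename-subst ρ σ (t =ᵗ u) = cong₂ _=ᵗ_ (rename-subst ρ σ t) (rename-subst ρ σ u)
rename-subst ρ σ (¬ᵗ t)   = cong ¬ᵗ (rename-subst ρ σ t)
rename-subst ρ σ (t ∨ᵗ u) = cong₂ _∨ᵗ_ (rename-subst ρ σ t) (rename-subst ρ σ u)
rename-subst ρ σ (ƛ t)    = cong ƛ (trans (rename-subst (extᵣ ρ) (extₛ σ) t) (subst-cong ext t))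
  where
  ext : ∀ i → rename (extᵣ ρ) (extₛ σ i) ≡ extₛ (rename ρ ∘ σ) i
  ext zero    = refl
  ext (suc i) = rename-↑ ρ (σ i)
rename-subst ρ σ (t · u)  = cong₂ _·_ (rename-subst ρ σ t) (rename-subst ρ σ u)
rename-subst ρ σ ℛ        = refl
rename-subst ρ σ 𝒜        = refl

subst-extₛ-↑ : ∀ σ t → subst (extₛ σ) (↑ t) ≡ ↑ (subst σ t)
subst-extₛ-↑ σ t = trans (subst-rename (extₛ σ) suc t) (sym (rename-subst suc σ t))

subst-subst : ∀ τ σ t → subst τ (subst σ t) ≡ subst (subst τ ∘ σ) t
subst-subst τ σ (var i)  = refl
subst-subst τ σ ⊥ᵗ       = refl
subst-subst τ σ 𝟎        = refl
subst-subst τ σ (𝐒 t)    = cong 𝐒 (subst-subst τ σ t)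
subst-subst τ σ (t =ᵗ u) = cong₂ _=ᵗ_ (subst-subst τ σ t) (subst-subst τ σ u)
subst-subst τ σ (¬ᵗ t)   = cong ¬ᵗ (subst-subst τ σ t)
subst-subst τ σ (t ∨ᵗ u) = cong₂ _∨ᵗ_ (subst-subst τ σ t) (subst-subst τ σ u)
subst-subst τ σ (ƛ t)    = cong ƛ (trans (subst-subst (extₛ τ) (extₛ σ) t) (subst-cong ext t))
  where
  ext : ∀ i → subst (extₛ τ) (extₛ σ i) ≡ extₛ (subst τ ∘ σ) i
  ext zero    = refl
  ext (suc i) = subst-extₛ-↑ τ (σ i)
subst-subst τ σ (t · u)  = cong₂ _·_ (subst-subst τ σ t) (subst-subst τ σ u)
subst-subst τ σ ℛ        = refl
subst-subst τ σ 𝒜        = refl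

extₛ-var : ∀ i → extₛ var i ≡ var i
extₛ-var zero    = refl
extₛ-var (suc i) = refl

subst-var : ∀ t → subst var t ≡ t
subst-var (var i)  = refl
subst-var ⊥ᵗ       = refl
subst-var 𝟎        = refl
subst-var (𝐒 t)    = cong 𝐒 (subst-var t)
subst-var (t =ᵗ u) = cong₂ _=ᵗ_ (subst-var t) (subst-var u)
subst-var (¬ᵗ t)   = cong ¬ᵗ (subst-var t)
subst-var (t ∨ᵗ u) = cong₂ _∨ᵗ_ (subst-var t) (subst-var u)
subst-var (ƛ t)    = cong ƛ (trans (subst-cong extₛ-var t) (subst-var t))
subst-var (t · u)  = cong₂ _·_ (subst-var t) (subst-var u)
subst-var ℛ        = refl
subst-var 𝒜        = refl

subst-num : ∀ σ k → subst σ (num k) ≡ num k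
subst-num σ zero    = refl
subst-num σ (suc k) = cong 𝐒 (subst-num σ k)

↑-⟨⟩ : ∀ t u → (↑ t) ⟨ u ⟩ ≡ t
↑-⟨⟩ t u = trans (subst-rename (β-sub u) suc t) (subst-var t)

subst-⟨⟩ : ∀ σ b t → subst σ (b ⟨ t ⟩) ≡ subst (extₛ σ) b ⟨ subst σ t ⟩
subst-⟨⟩ σ b t = begin
  subst σ (b ⟨ t ⟩)                              ≡⟨ subst-subst σ (β-sub t) b ⟩
  subst (subst σ ∘ β-sub t) b                    ≡⟨ subst-cong pointwise b ⟩
  subst (subst (β-sub (subst σ t)) ∘ extₛ σ) b   ≡⟨ subst-subst _ (extₛ σ) b ⟨
  subst (extₛ σ) b ⟨ subst σ t ⟩                 ∎
  where
  pointwise : ∀ i → subst σ (β-sub t i) ≡ extₛ σ i ⟨ subst σ t ⟩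
  pointwise zero    = refl
  pointwise (suc i) = sym (↑-⟨⟩ (σ i) (subst σ t))

-- Extension and update of environments

infixr 5 _•_
_•_ : Term → (ℕ → Term) → ℕ → Term
(t • σ) zero    = t
(t • σ) (suc i) = σ i

subst-•-↑ : ∀ t σ u → subst (t • σ) (↑ u) ≡ subst σ u
subst-•-↑ t σ u = subst-rename (t • σ) suc u

infix 11 _[_≔_]
_[_≔_] : (ℕ → Term) → ℕ → Term → ℕ → Term
(σ [ i ≔ t ]) j with i ≟ j
... | yes _ = t
... | no  _ = σ j

≔-same : ∀ σ i t → (σ [ i ≔ t ]) i ≡ t
≔-same σ i t with i ≟ i
... | yes _ = refl
... | no ¬p = contradiction refl ¬p

≔-overwrite : ∀ σ i t u j → (σ [ i ≔ t ] [ i ≔ u ]) j ≡ (σ [ i ≔ u ]) j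
≔-overwrite σ i t u j with i ≟ j in eq
... | yes _ = refl
... | no  _ rewrite eq = refl

-- Turns a substitution inside a judgment into an update of the environment; validity ranges over
-- all environments, so the updated one is covered as well.
subst-[↦] : ∀ σ i s t → subst σ ([ i ↦ s ] t) ≡ subst (σ [ i ≔ subst σ s ]) t
subst-[↦] σ i s t = trans (subst-subst σ (single i s) t) (subst-cong pointwise t)
  where
  pointwise : ∀ j → subst σ (single i s j) ≡ (σ [ i ≔ subst σ s ]) j
  pointwise j with i ≟ j
  ... | yes _ = refl
  ... | no  _ = refl

subst-fresh : ∀ σ {i} s t → ¬ (i ∈fv t) → subst (σ [ i ≔ s ]) t ≡ subst σ t
subst-fresh σ {i} s t fresh = subst-cong-fv t pointwise
  where
  pointwise : ∀ j → j ∈fv t → (σ [ i ≔ s ]) j ≡ σ j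
  pointwise j p with i ≟ j
  ... | yes refl = contradiction p fresh
  ... | no  _    = refl

-- Evaluation relative to a set of accepted quantifications

infix 4 _⊩_↓_ _⊩_⟶_

-- With `P` standing in for the infinitary clause, evaluations are finite trees and monotone in `P`.
-- Head reduction replaces the argument lists of `⇓`; the two relations are mutual because the
-- recursor evaluates its last argument.
data _⊩_↓_ (P : Term → Set) : Term → ℕ → Set
data _⊩_⟶_ (P : Term → Set) : Term → Term → Set

data _⊩_↓_ P where
  ↓-𝟎   : P ⊩ 𝟎 ↓ 0
  ↓-𝐒   : ∀ {t n} → P ⊩ t ↓ n → P ⊩ 𝐒 t ↓ suc n
  ↓-=   : ∀ {t u n} → P ⊩ t ↓ n → P ⊩ u ↓ n → P ⊩ t =ᵗ u ↓ 1
  ↓-≠   : ∀ {t u m n} → P ⊩ t ↓ m → P ⊩ u ↓ n → m ≢ n → P ⊩ t =ᵗ u ↓ 0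
  ↓-¬₁  : ∀ {t} → P ⊩ t ↓ 1 → P ⊩ ¬ᵗ t ↓ 0
  ↓-¬₀  : ∀ {t} → P ⊩ t ↓ 0 → P ⊩ ¬ᵗ t ↓ 1
  ↓-∨₁ˡ : ∀ {t u} → P ⊩ t ↓ 1 → P ⊩ t ∨ᵗ u ↓ 1
  ↓-∨₁ʳ : ∀ {t u} → P ⊩ u ↓ 1 → P ⊩ t ∨ᵗ u ↓ 1
  ↓-∨₀  : ∀ {t u} → P ⊩ t ↓ 0 → P ⊩ u ↓ 0 → P ⊩ t ∨ᵗ u ↓ 0
  ↓-𝒜₁  : ∀ {f} → P f → P ⊩ 𝒜 · f ↓ 1
  ↓-𝒜₀  : ∀ {f} k → P ⊩ f · num k ↓ 0 → P ⊩ 𝒜 · f ↓ 0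
  ↓-⟶   : ∀ {t u n} → P ⊩ t ⟶ u → P ⊩ u ↓ n → P ⊩ t ↓ n

data _⊩_⟶_ P where
  ⟶-β   : ∀ {b t} → P ⊩ ƛ b · t ⟶ b ⟨ t ⟩
  ⟶-ℛ0  : ∀ {g h a} → P ⊩ a ↓ 0 → P ⊩ ℛ · g · h · a ⟶ g
  ⟶-ℛS  : ∀ {g h a k} → P ⊩ a ↓ suc k →
          P ⊩ ℛ · g · h · a ⟶ h · num k · (ℛ · g · h · num k)
  ⟶-app : ∀ {t t′ u} → P ⊩ t ⟶ t′ → P ⊩ t · u ⟶ t′ · u

↓-mono : ∀ {P Q t n} → (∀ {f} → P f → Q f) → P ⊩ t ↓ n → Q ⊩ t ↓ n
⟶-mono : ∀ {P Q t u} → (∀ {f} → P f → Q f) → P ⊩ t ⟶ u → Q ⊩ t ⟶ u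

↓-mono ι ↓-𝟎         = ↓-𝟎
↓-mono ι (↓-𝐒 d)     = ↓-𝐒 (↓-mono ι d)
↓-mono ι (↓-= d e)   = ↓-= (↓-mono ι d) (↓-mono ι e)
↓-mono ι (↓-≠ d e p) = ↓-≠ (↓-mono ι d) (↓-mono ι e) p
↓-mono ι (↓-¬₁ d)    = ↓-¬₁ (↓-mono ι d)
↓-mono ι (↓-¬₀ d)    = ↓-¬₀ (↓-mono ι d)
↓-mono ι (↓-∨₁ˡ d)   = ↓-∨₁ˡ (↓-mono ι d)
↓-mono ι (↓-∨₁ʳ d)   = ↓-∨₁ʳ (↓-mono ι d)
↓-mono ι (↓-∨₀ d e)  = ↓-∨₀ (↓-mono ι d) (↓-mono ι e)
↓-mono ι (↓-𝒜₁ p)    = ↓-𝒜₁ (ι p)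
↓-mono ι (↓-𝒜₀ k d)  = ↓-𝒜₀ k (↓-mono ι d)
↓-mono ι (↓-⟶ r d)   = ↓-⟶ (⟶-mono ι r) (↓-mono ι d)

⟶-mono ι ⟶-β       = ⟶-β
⟶-mono ι (⟶-ℛ0 d)  = ⟶-ℛ0 (↓-mono ι d)
⟶-mono ι (⟶-ℛS d)  = ⟶-ℛS (↓-mono ι d)
⟶-mono ι (⟶-app r) = ⟶-app (⟶-mono ι r)

↓-num : ∀ {P} k → P ⊩ num k ↓ k
↓-num zero    = ↓-𝟎
↓-num (suc k) = ↓-𝐒 (↓-num k)

▷⇒⟶ : ∀ {P t u} → t ▷ u → P ⊩ t ⟶ u
▷⇒⟶ ▷-β       = ⟶-β
▷⇒⟶ ▷-ℛ0      = ⟶-ℛ0 ↓-𝟎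
▷⇒⟶ (▷-ℛS n)  = ⟶-ℛS (↓-num (suc n))
▷⇒⟶ (▷-app r) = ⟶-app (▷⇒⟶ r)

⟶-·* : ∀ {P t u} ss → P ⊩ t ⟶ u → P ⊩ t ·* ss ⟶ u ·* ss
⟶-·* []       r = r
⟶-·* (s ∷ ss) r = ⟶-·* ss (⟶-app r)

-- Stages

data Stage : Set₁ where
  sup : {I : Set} → (I → Stage) → Stage

-- The index `i` precedes `k`: all instances are true at one earlier branch. Under ¬¬ the evaluation
-- relation is not strictly positive, hence recursion on the stage instead of an inductive clause.
Accepts : Stage → Term → Set
Accepts (sup α) f = ∃[ i ] ∀ k → ¬ ¬ (Accepts (α i) ⊩ f · num k ↓ 1)

infix 4 _⊨_↓_ _≼_

_⊨_↓_ : Stage → Term → ℕ → Set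
α ⊨ t ↓ n = ¬ ¬ (Accepts α ⊩ t ↓ n)

_≼_ : Stage → Stage → Set
α ≼ β = ∀ {f} → Accepts α f → Accepts β f

⊨-mono : ∀ {α β t n} → α ≼ β → α ⊨ t ↓ n → β ⊨ t ↓ n
⊨-mono α≼β d = ↓-mono α≼β <$> d

Index : Stage → Set
Index (sup {I} _) = I

branch : ∀ α → Index α → Stage
branch (sup α) = α

infixl 6 _⊔_
-- Pools the branches of both sides without adding a level, in contrast to `next`.
_⊔_ : Stage → Stage → Stage
sup α ⊔ sup β = sup [ α , β ]′

⊔-upperˡ : ∀ α β → α ≼ α ⊔ β
⊔-upperˡ (sup α) (sup β) (i , p) = inj₁ i , p

⊔-upperʳ : ∀ α β → β ≼ α ⊔ β
⊔-upperʳ (sup α) (sup β) (i , p) = inj₂ i , p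

⋃ : {I : Set} → (I → Stage) → Stage
⋃ {I} α = sup {Σ I (Index ∘ α)} λ (i , j) → branch (α i) j

Accepts-branch : ∀ α {f} → Accepts α f →
                 ∃[ i ] ∀ k → branch α i ⊨ f · num k ↓ 1
Accepts-branch (sup α) p = p

⋃-upper : ∀ {I : Set} (α : I → Stage) i → α i ≼ ⋃ α
⋃-upper α i p = let j , q = Accepts-branch (α i) p in (i , j) , q

next : Stage → Stage
next α = sup {⊤} (const α)

down : Stage → Stage
down (sup α) = ⋃ α

-- Which branch makes the instances true depends on `f`, and so on the environment. Pooling the
-- branches of all branches gives a bound that depends on `α` alone.
Accepts-down : ∀ α {f} → Accepts α f → ∀ k → down α ⊨ f · num k ↓ 1
Accepts-down (sup α) (i , p) k = ⊨-mono {α i} {⋃ α} (⋃-upper α i) (p k)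

-- The critical clash is an accepted quantification against a false instance. It descends to a
-- branch of the accepting stage while the other stage stays put, so two unrelated stages can be
-- compared.
↓-functional : ∀ α β {t m n} → Accepts α ⊩ t ↓ m → Accepts β ⊩ t ↓ n → m ≡ n
⟶-deterministic : ∀ α β {t u v} → Accepts α ⊩ t ⟶ u → Accepts β ⊩ t ⟶ v → u ≡ v

↓-functional α β ↓-𝟎 ↓-𝟎 = refl
↓-functional α β (↓-𝐒 d) (↓-𝐒 e) = cong suc (↓-functional α β d e)
↓-functional α β (↓-= _ _) (↓-= _ _) = refl
↓-functional α β (↓-= d d′) (↓-≠ e e′ m≢n) =
  contradiction (trans (sym (↓-functional α β d e)) (↓-functional α β d′ e′)) m≢n
↓-functional α β (↓-≠ d d′ m≢n) (↓-= e e′) =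
  contradiction (trans (↓-functional α β d e) (sym (↓-functional α β d′ e′))) m≢n
↓-functional α β (↓-≠ _ _ _) (↓-≠ _ _ _) = refl
↓-functional α β (↓-¬₁ d) (↓-¬₁ e) = refl
↓-functional α β (↓-¬₁ d) (↓-¬₀ e) = sym (↓-functional α β d e)
↓-functional α β (↓-¬₀ d) (↓-¬₁ e) = sym (↓-functional α β d e)
↓-functional α β (↓-¬₀ d) (↓-¬₀ e) = refl
↓-functional α β (↓-∨₁ˡ d) (↓-∨₁ˡ e) = refl
↓-functional α β (↓-∨₁ˡ d) (↓-∨₁ʳ e) = refl
↓-functional α β (↓-∨₁ʳ d) (↓-∨₁ˡ e) = refl
↓-functional α β (↓-∨₁ʳ d) (↓-∨₁ʳ e) = refl
↓-functional α β (↓-∨₁ˡ d) (↓-∨₀ e e′) = ↓-functional α β d e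
↓-functional α β (↓-∨₁ʳ d) (↓-∨₀ e e′) = ↓-functional α β d e′
↓-functional α β (↓-∨₀ d d′) (↓-∨₁ˡ e) = ↓-functional α β d e
↓-functional α β (↓-∨₀ d d′) (↓-∨₁ʳ e) = ↓-functional α β d′ e
↓-functional α β (↓-∨₀ _ _) (↓-∨₀ _ _) = refl
↓-functional α β (↓-𝒜₁ _) (↓-𝒜₁ _) = refl
↓-functional (sup α) β (↓-𝒜₁ (i , p)) (↓-𝒜₀ k e) =
  -- The true instance is known only up to ¬¬, which decidable equality of numbers removes.
  decidable-stable (_ ≟ _) ((λ d → ↓-functional (α i) β d e) <$> p k)
↓-functional α (sup β) (↓-𝒜₀ k d) (↓-𝒜₁ (i , p)) =
  decidable-stable (_ ≟ _) ((λ e → ↓-functional α (β i) d e) <$> p k)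
↓-functional α β (↓-𝒜₀ _ _) (↓-𝒜₀ _ _) = refl
↓-functional α β (↓-𝒜₁ _) (↓-⟶ (⟶-app ()) _)
↓-functional α β (↓-𝒜₀ _ _) (↓-⟶ (⟶-app ()) _)
↓-functional α β (↓-⟶ (⟶-app ()) _) (↓-𝒜₁ _)
↓-functional α β (↓-⟶ (⟶-app ()) _) (↓-𝒜₀ _ _)
↓-functional α β (↓-⟶ r d) (↓-⟶ s e) with refl ← ⟶-deterministic α β r s =
  ↓-functional α β d e

⟶-deterministic α β ⟶-β ⟶-β = refl
⟶-deterministic α β (⟶-ℛ0 _) (⟶-ℛ0 _) = refl
⟶-deterministic α β (⟶-ℛ0 d) (⟶-ℛS e) = contradiction (↓-functional α β d e) λ ()
⟶-deterministic α β (⟶-ℛS d) (⟶-ℛ0 e) = contradiction (↓-functional α β d e) λ ()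
⟶-deterministic α β (⟶-ℛS d) (⟶-ℛS e) with refl ← ↓-functional α β d e = refl
⟶-deterministic α β (⟶-app r) (⟶-app s) = cong (_· _) (⟶-deterministic α β r s)
⟶-deterministic α β (⟶-ℛ0 _) (⟶-app (⟶-app (⟶-app ())))
⟶-deterministic α β (⟶-ℛS _) (⟶-app (⟶-app (⟶-app ())))
⟶-deterministic α β (⟶-app (⟶-app (⟶-app ()))) (⟶-ℛ0 _)
⟶-deterministic α β (⟶-app (⟶-app (⟶-app ()))) (⟶-ℛS _)

-- By determinism, an evaluation of a term with a head step must begin with that very step.
↓-reduct : ∀ α {t u n} → t ▷ u → Accepts α ⊩ t ↓ n → Accepts α ⊩ u ↓ n
↓-reduct α r d = reduct d (▷⇒⟶ r)
  where
  reduct : ∀ {t u n} → Accepts α ⊩ t ↓ n → Accepts α ⊩ t ⟶ u → Accepts α ⊩ u ↓ n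
  reduct (↓-⟶ s d) r with refl ← ⟶-deterministic α α r s = d
  reduct (↓-𝒜₁ _) (⟶-app ())
  reduct (↓-𝒜₀ _ _) (⟶-app ())

-- Stability under substitution

▷-subst : ∀ σ {t u} → t ▷ u → subst σ t ▷ subst σ u
▷-subst σ (▷-β {b} {t}) = transport (subst σ (ƛ b · t) ▷_) (sym (subst-⟨⟩ σ b t)) ▷-β
▷-subst σ ▷-ℛ0 = ▷-ℛ0
▷-subst σ (▷-ℛS n) rewrite subst-num σ n = ▷-ℛS n
▷-subst σ (▷-app r) = ▷-app (▷-subst σ r)

-- An evaluation never inspects a variable, so it survives any substitution. Replacement needs this,
-- since replaced subterms may be open and lie under a binder.
Accepts-subst : ∀ α σ {f} → Accepts α f → Accepts α (subst σ f)
↓-subst : ∀ α σ {t n} → Accepts α ⊩ t ↓ n → Accepts α ⊩ subst σ t ↓ n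
⟶-subst : ∀ α σ {t u} → Accepts α ⊩ t ⟶ u → Accepts α ⊩ subst σ t ⟶ subst σ u

Accepts-subst (sup α) σ {f} (i , p) = i , λ k → do
  d ← p k
  return (transport (λ m → Accepts (α i) ⊩ subst σ f · m ↓ 1) (subst-num σ k)
           (↓-subst (α i) σ d))

↓-subst α σ ↓-𝟎         = ↓-𝟎
↓-subst α σ (↓-𝐒 d)     = ↓-𝐒 (↓-subst α σ d)
↓-subst α σ (↓-= d e)   = ↓-= (↓-subst α σ d) (↓-subst α σ e)
↓-subst α σ (↓-≠ d e p) = ↓-≠ (↓-subst α σ d) (↓-subst α σ e) p
↓-subst α σ (↓-¬₁ d)    = ↓-¬₁ (↓-subst α σ d)
↓-subst α σ (↓-¬₀ d)    = ↓-¬₀ (↓-subst α σ d)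
↓-subst α σ (↓-∨₁ˡ d)   = ↓-∨₁ˡ (↓-subst α σ d)
↓-subst α σ (↓-∨₁ʳ d)   = ↓-∨₁ʳ (↓-subst α σ d)
↓-subst α σ (↓-∨₀ d e)  = ↓-∨₀ (↓-subst α σ d) (↓-subst α σ e)
↓-subst α σ (↓-𝒜₁ p)    = ↓-𝒜₁ (Accepts-subst α σ p)
↓-subst α σ (↓-𝒜₀ {f} k d) =
  ↓-𝒜₀ k (transport (λ m → Accepts α ⊩ subst σ f · m ↓ 0) (subst-num σ k) (↓-subst α σ d))
↓-subst α σ (↓-⟶ r d)   = ↓-⟶ (⟶-subst α σ r) (↓-subst α σ d)

⟶-subst α σ (⟶-β {b} {t}) =
  transport (Accepts α ⊩ subst σ (ƛ b · t) ⟶_) (sym (subst-⟨⟩ σ b t)) ⟶-β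
⟶-subst α σ (⟶-ℛ0 d) = ⟶-ℛ0 (↓-subst α σ d)
⟶-subst α σ (⟶-ℛS {k = k} d) rewrite subst-num σ k = ⟶-ℛS (↓-subst α σ d)
⟶-subst α σ (⟶-app r) = ⟶-app (⟶-subst α σ r)

-- Replacement

infix 4 _⊴_

-- Prefix order on application spines: `t` is `s` followed by further arguments.
data _⊴_ (s : Term) : Term → Set where
  ⊴-refl : s ⊴ s
  ⊴-app  : ∀ {t u} → s ⊴ t → s ⊴ t · u

data Canonical : Term → Set where
  𝟎-canonical : Canonical 𝟎
  𝐒-canonical : ∀ {t} → Canonical (𝐒 t)
  =-canonical : ∀ {t u} → Canonical (t =ᵗ u)
  ¬-canonical : ∀ {t} → Canonical (¬ᵗ t)
  ∨-canonical : ∀ {t u} → Canonical (t ∨ᵗ u)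
  𝒜-canonical : ∀ {f} → Canonical (𝒜 · f)

canonical-stuck : ∀ {P s t u v} → s ⊴ t → P ⊩ t · u ⟶ v → ¬ Canonical s
canonical-stuck ⊴-refl (⟶-app (⟶-app ())) 𝒜-canonical
canonical-stuck (⊴-app ⊴-refl) (⟶-ℛ0 _) ()
canonical-stuck (⊴-app (⊴-app ⊴-refl)) (⟶-ℛ0 _) ()
canonical-stuck (⊴-app ⊴-refl) (⟶-ℛS _) ()
canonical-stuck (⊴-app (⊴-app ⊴-refl)) (⟶-ℛS _) ()
canonical-stuck (⊴-app p) (⟶-app r) c = canonical-stuck p r c

⟶-prefix : ∀ α β {s s′ t u v} → s ⊴ t → Accepts α ⊩ s ⟶ s′ → Accepts β ⊩ t · u ⟶ v →
           ∃[ t′ ] v ≡ t′ · u × s′ ⊴ t′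
⟶-prefix α β ⊴-refl r (⟶-app r′) with refl ← ⟶-deterministic α β r r′ =
  _ , refl , ⊴-refl
⟶-prefix α β ⊴-refl (⟶-app (⟶-app ())) (⟶-ℛ0 _)
⟶-prefix α β ⊴-refl (⟶-app (⟶-app ())) (⟶-ℛS _)
⟶-prefix α β (⊴-app ⊴-refl) (⟶-app ()) (⟶-ℛ0 _)
⟶-prefix α β (⊴-app (⊴-app ⊴-refl)) () (⟶-ℛ0 _)
⟶-prefix α β (⊴-app ⊴-refl) (⟶-app ()) (⟶-ℛS _)
⟶-prefix α β (⊴-app (⊴-app ⊴-refl)) () (⟶-ℛS _)
⟶-prefix α β (⊴-app p) r (⟶-app r′) with _ , refl , q ← ⟶-prefix α β p r r′ =
  _ , refl , ⊴-app q

-- Steps of the whole term take place inside the prefix `s` for as long as `s` reduces; once `s` is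
-- canonical, the applied term is stuck.
value-not-applied : ∀ α β {s t u m n} → Accepts α ⊩ s ↓ m → s ⊴ t → ¬ (Accepts β ⊩ t · u ↓ n)
value-not-applied α β (↓-⟶ () _) ⊴-refl (↓-𝒜₁ _)
value-not-applied α β (↓-⟶ () _) ⊴-refl (↓-𝒜₀ _ _)
value-not-applied α β (↓-⟶ r d) p (↓-⟶ r′ e) with _ , refl , q ← ⟶-prefix α β p r r′ =
  value-not-applied α β d q e
value-not-applied α β ↓-𝟎         p (↓-⟶ r _) = canonical-stuck p r 𝟎-canonical
value-not-applied α β (↓-𝐒 _)     p (↓-⟶ r _) = canonical-stuck p r 𝐒-canonical
value-not-applied α β (↓-= _ _)   p (↓-⟶ r _) = canonical-stuck p r =-canonical
value-not-applied α β (↓-≠ _ _ _) p (↓-⟶ r _) = canonical-stuck p r =-canonical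
value-not-applied α β (↓-¬₁ _)    p (↓-⟶ r _) = canonical-stuck p r ¬-canonical
value-not-applied α β (↓-¬₀ _)    p (↓-⟶ r _) = canonical-stuck p r ¬-canonical
value-not-applied α β (↓-∨₁ˡ _)   p (↓-⟶ r _) = canonical-stuck p r ∨-canonical
value-not-applied α β (↓-∨₁ʳ _)   p (↓-⟶ r _) = canonical-stuck p r ∨-canonical
value-not-applied α β (↓-∨₀ _ _)  p (↓-⟶ r _) = canonical-stuck p r ∨-canonical
value-not-applied α β (↓-𝒜₁ _)    p (↓-⟶ r _) = canonical-stuck p r 𝒜-canonical
value-not-applied α β (↓-𝒜₀ _ _)  p (↓-⟶ r _) = canonical-stuck p r 𝒜-canonical

module Replacement (β : Stage) where

  infix 4 _≈_
  infixl 10 _≈·_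

  -- Replacement of subterms that share a value at `β`. There is no transitivity clause, so
  -- evaluations can be followed clause by clause.
  data _≈_ : Term → Term → Set where
    base : ∀ {t u n} → β ⊨ t ↓ n → β ⊨ u ↓ n → t ≈ u
    ≈var : ∀ i → var i ≈ var i
    ≈⊥   : ⊥ᵗ ≈ ⊥ᵗ
    ≈𝟎   : 𝟎 ≈ 𝟎
    ≈𝐒   : ∀ {t t′} → t ≈ t′ → 𝐒 t ≈ 𝐒 t′
    _≈=_ : ∀ {t t′ u u′} → t ≈ t′ → u ≈ u′ → t =ᵗ u ≈ t′ =ᵗ u′
    ≈¬   : ∀ {t t′} → t ≈ t′ → ¬ᵗ t ≈ ¬ᵗ t′
    _≈∨_ : ∀ {t t′ u u′} → t ≈ t′ → u ≈ u′ → t ∨ᵗ u ≈ t′ ∨ᵗ u′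
    ≈ƛ   : ∀ {t t′} → t ≈ t′ → ƛ t ≈ ƛ t′
    _≈·_ : ∀ {t t′ u u′} → t ≈ t′ → u ≈ u′ → t · u ≈ t′ · u′
    ≈ℛ   : ℛ ≈ ℛ
    ≈𝒜   : 𝒜 ≈ 𝒜

  ≈-refl : ∀ t → t ≈ t
  ≈-refl (var i)  = ≈var i
  ≈-refl ⊥ᵗ       = ≈⊥
  ≈-refl 𝟎        = ≈𝟎
  ≈-refl (𝐒 t)    = ≈𝐒 (≈-refl t)
  ≈-refl (t =ᵗ u) = ≈-refl t ≈= ≈-refl u
  ≈-refl (¬ᵗ t)   = ≈¬ (≈-refl t)
  ≈-refl (t ∨ᵗ u) = ≈-refl t ≈∨ ≈-refl u
  ≈-refl (ƛ t)    = ≈ƛ (≈-refl t)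
  ≈-refl (t · u)  = ≈-refl t ≈· ≈-refl u
  ≈-refl ℛ        = ≈ℛ
  ≈-refl 𝒜        = ≈𝒜

  ≈-rename : ∀ {t u} ρ → t ≈ u → rename ρ t ≈ rename ρ u
  ≈-rename {t} {u} ρ (base d e)
    rewrite rename-as-subst ρ t | rename-as-subst ρ u =
    base (↓-subst β (var ∘ ρ) <$> d) (↓-subst β (var ∘ ρ) <$> e)
  ≈-rename ρ (≈var i) = ≈var (ρ i)
  ≈-rename ρ ≈⊥       = ≈⊥
  ≈-rename ρ ≈𝟎       = ≈𝟎
  ≈-rename ρ (≈𝐒 p)   = ≈𝐒 (≈-rename ρ p)
  ≈-rename ρ (p ≈= q) = ≈-rename ρ p ≈= ≈-rename ρ q
  ≈-rename ρ (≈¬ p)   = ≈¬ (≈-rename ρ p)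
  ≈-rename ρ (p ≈∨ q) = ≈-rename ρ p ≈∨ ≈-rename ρ q
  ≈-rename ρ (≈ƛ p)   = ≈ƛ (≈-rename (extᵣ ρ) p)
  ≈-rename ρ (p ≈· q) = ≈-rename ρ p ≈· ≈-rename ρ q
  ≈-rename ρ ≈ℛ       = ≈ℛ
  ≈-rename ρ ≈𝒜       = ≈𝒜

  ≈-extₛ : ∀ {σ τ} → (∀ i → σ i ≈ τ i) → ∀ i → extₛ σ i ≈ extₛ τ i
  ≈-extₛ eq zero    = ≈var zero
  ≈-extₛ eq (suc i) = ≈-rename suc (eq i)

  ≈-subst : ∀ {σ τ t u} → (∀ i → σ i ≈ τ i) → t ≈ u → subst σ t ≈ subst τ u
  ≈-subst {σ} {τ} eq (base d e) = base (↓-subst β σ <$> d) (↓-subst β τ <$> e)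
  ≈-subst eq (≈var i) = eq i
  ≈-subst eq ≈⊥       = ≈⊥
  ≈-subst eq ≈𝟎       = ≈𝟎
  ≈-subst eq (≈𝐒 p)   = ≈𝐒 (≈-subst eq p)
  ≈-subst eq (p ≈= q) = ≈-subst eq p ≈= ≈-subst eq q
  ≈-subst eq (≈¬ p)   = ≈¬ (≈-subst eq p)
  ≈-subst eq (p ≈∨ q) = ≈-subst eq p ≈∨ ≈-subst eq q
  ≈-subst eq (≈ƛ p)   = ≈ƛ (≈-subst (≈-extₛ eq) p)
  ≈-subst eq (p ≈· q) = ≈-subst eq p ≈· ≈-subst eq q
  ≈-subst eq ≈ℛ       = ≈ℛ
  ≈-subst eq ≈𝒜       = ≈𝒜

  ≈-⟨⟩ : ∀ {b b′ t t′} → b ≈ b′ → t ≈ t′ → b ⟨ t ⟩ ≈ b′ ⟨ t′ ⟩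
  ≈-⟨⟩ {t = t} {t′} p q = ≈-subst pointwise p
    where
    pointwise : ∀ i → β-sub t i ≈ β-sub t′ i
    pointwise zero    = q
    pointwise (suc i) = ≈var i

  -- A replaced subterm may surface under nested quantifiers, where its value is read at a branch of
  -- `α`; therefore `β` is joined in at every level.
  after : Stage → Stage
  after (sup α) = β ⊔ sup (λ i → after (α i))

  after-upper : ∀ α → β ≼ after α
  after-upper (sup α) = ⊔-upperˡ β (sup (λ i → after (α i)))

  -- The recursion is on the stage and then on the evaluation, not on the replacement, which may
  -- grow in a β-step. The stage decreases when an accepted quantification is opened.
  Accepts-≈ : ∀ α {f f′} → f ≈ f′ → Accepts α f → Accepts (after α) f′
  ↓-≈ : ∀ α {t t′ n} → t ≈ t′ → Accepts α ⊩ t ↓ n → after α ⊨ t′ ↓ n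
  -- A term with a value may occur in head position, where its partner need
  -- not reduce in step; the second alternative records this.
  ⟶-≈ : ∀ α {t t′ u u′ v} → t ≈ t′ → u ≈ u′ → Accepts α ⊩ t · u ⟶ v →
        ¬ ¬ ((∃[ v′ ] (Accepts (after α) ⊩ t′ · u′ ⟶ v′) × v ≈ v′) ⊎
             (∃[ s ] ∃[ n ] s ⊴ t × (Accepts β ⊩ s ↓ n)))

  Accepts-≈ (sup α) p (i , q) =
    ⊔-upperʳ β (sup (λ i → after (α i)))
      (i , λ k → q k >>= ↓-≈ (α i) (p ≈· ≈-refl (num k)))

  ↓-≈ α (base p q) d = do
    d₁ ← p
    d₂ ← q
    -- Values agree across `β` and `α`, so the given value is the shared one.
    return (transport (Accepts (after α) ⊩ _ ↓_) (↓-functional β α d₁ d)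
             (↓-mono (after-upper α) d₂))
  ↓-≈ α (≈var _) (↓-⟶ () _)
  ↓-≈ α ≈⊥       (↓-⟶ () _)
  ↓-≈ α (≈ƛ _)   (↓-⟶ () _)
  ↓-≈ α ≈ℛ       (↓-⟶ () _)
  ↓-≈ α ≈𝒜       (↓-⟶ () _)
  ↓-≈ α ≈𝟎 ↓-𝟎 = return ↓-𝟎
  ↓-≈ α (≈𝐒 p) (↓-𝐒 d) = ↓-𝐒 <$> ↓-≈ α p d
  ↓-≈ α (p ≈= q) (↓-= d e) = do
    d′ ← ↓-≈ α p d
    e′ ← ↓-≈ α q e
    return (↓-= d′ e′)
  ↓-≈ α (p ≈= q) (↓-≠ d e m≢n) = do
    d′ ← ↓-≈ α p d
    e′ ← ↓-≈ α q e
    return (↓-≠ d′ e′ m≢n)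
  ↓-≈ α (≈¬ p) (↓-¬₁ d) = ↓-¬₁ <$> ↓-≈ α p d
  ↓-≈ α (≈¬ p) (↓-¬₀ d) = ↓-¬₀ <$> ↓-≈ α p d
  ↓-≈ α (p ≈∨ q) (↓-∨₁ˡ d) = ↓-∨₁ˡ <$> ↓-≈ α p d
  ↓-≈ α (p ≈∨ q) (↓-∨₁ʳ d) = ↓-∨₁ʳ <$> ↓-≈ α q d
  ↓-≈ α (p ≈∨ q) (↓-∨₀ d e) = do
    d′ ← ↓-≈ α p d
    e′ ← ↓-≈ α q e
    return (↓-∨₀ d′ e′)
  ↓-≈ α (≈𝒜 ≈· p) (↓-𝒜₁ q) = return (↓-𝒜₁ (Accepts-≈ α p q))
  -- A bare `𝒜` has no value, so it cannot be a replaced subterm.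
  ↓-≈ α (base p _ ≈· _) (↓-𝒜₁ _) = p >>= λ { (↓-⟶ () _) }
  ↓-≈ α (≈𝒜 ≈· p) (↓-𝒜₀ k d) = ↓-𝒜₀ k <$> ↓-≈ α (p ≈· ≈-refl (num k)) d
  ↓-≈ α (base p _ ≈· _) (↓-𝒜₀ _ _) = p >>= λ { (↓-⟶ () _) }
  ↓-≈ α (p ≈· q) (↓-⟶ r d) = ⟶-≈ α p q r >>= λ where
    (inj₁ (_ , r′ , v≈v′))  → ↓-⟶ r′ <$> ↓-≈ α v≈v′ d
    (inj₂ (_ , _ , s⊴t , e)) → contradiction (↓-⟶ r d) (value-not-applied β α e s⊴t)

  ⟶-≈ α (≈ƛ p) q ⟶-β = return (inj₁ (_ , ⟶-β , ≈-⟨⟩ p q))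
  ⟶-≈ α (base p _) _ ⟶-β = p >>= λ { (↓-⟶ () _) }
  ⟶-≈ α (≈ℛ ≈· g ≈· h) a (⟶-ℛ0 d) = do
    d′ ← ↓-≈ α a d
    return (inj₁ (_ , ⟶-ℛ0 d′ , g))
  ⟶-≈ α (base p _) _ (⟶-ℛ0 _) = p >>= λ { (↓-⟶ (⟶-app (⟶-app ())) _) }
  ⟶-≈ α (base p _ ≈· _) _ (⟶-ℛ0 _) = p >>= λ { (↓-⟶ (⟶-app ()) _) }
  ⟶-≈ α (base p _ ≈· _ ≈· _) _ (⟶-ℛ0 _) = p >>= λ { (↓-⟶ () _) }
  ⟶-≈ α (≈ℛ ≈· g ≈· h) a (⟶-ℛS {k = k} d) = do
    d′ ← ↓-≈ α a d
    return (inj₁ (_ , ⟶-ℛS d′ , h ≈· ≈-refl (num k) ≈· (≈ℛ ≈· g ≈· h ≈· ≈-refl (num k))))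
  ⟶-≈ α (base p _) _ (⟶-ℛS _) = p >>= λ { (↓-⟶ (⟶-app (⟶-app ())) _) }
  ⟶-≈ α (base p _ ≈· _) _ (⟶-ℛS _) = p >>= λ { (↓-⟶ (⟶-app ()) _) }
  ⟶-≈ α (base p _ ≈· _ ≈· _) _ (⟶-ℛS _) = p >>= λ { (↓-⟶ () _) }
  ⟶-≈ α (base p _) _ (⟶-app r) = do
    d ← p
    return (inj₂ (_ , _ , ⊴-refl , d))
  ⟶-≈ α (p ≈· q) u (⟶-app r) = ⟶-≈ α p q r >>= λ where
    (inj₁ (_ , r′ , v≈v′))   → return (inj₁ (_ , ⟶-app r′ , v≈v′ ≈· u))
    (inj₂ (_ , _ , s⊴t , e)) → return (inj₂ (_ , _ , ⊴-app s⊴t , e))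

  ≈-≔ : ∀ σ i {a b n} → β ⊨ a ↓ n → β ⊨ b ↓ n →
        ∀ t → subst (σ [ i ≔ a ]) t ≈ subst (σ [ i ≔ b ]) t
  ≈-≔ σ i {a} {b} d e t = ≈-subst pointwise (≈-refl t)
    where
    pointwise : ∀ j → (σ [ i ≔ a ]) j ≈ (σ [ i ≔ b ]) j
    pointwise j with i ≟ j
    ... | yes _ = base d e
    ... | no  _ = ≈-refl (σ j)

open Replacement

-- Soundness

infix 4 _,_⊨_

_,_⊨_ : Stage → (ℕ → Term) → Context → Set
α , σ ⊨ Γ = All (λ g → α ⊨ subst σ g ↓ 1) Γ

⊨ᶜ-mono : ∀ {α β} σ Γ → α ≼ β → α , σ ⊨ Γ → β , σ ⊨ Γ
⊨ᶜ-mono {α} {β} σ Γ α≼β = All.map (⊨-mono {α} {β} α≼β)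

⊨ᶜ-↑ : ∀ α t σ Γ → α , σ ⊨ Γ → α , t • σ ⊨ map ↑ Γ
⊨ᶜ-↑ α t σ Γ hs =
  All.map⁺ (All.map (λ {g} → transport (α ⊨_↓ 1) (sym (subst-•-↑ t σ g))) hs)

Entails : Stage → Stage → (ℕ → Term) → Judgment → Set
Entails α β σ (Γ ⊢ c) = α , σ ⊨ Γ → β ⊨ subst σ c ↓ 1

-- `stage` does not depend on σ, so the premise of ∀-intro holds for all
-- numerals at one common stage.
record Valid (j : Judgment) : Set₁ where
  constructor valid
  field
    stage : Stage → Stage
    holds : ∀ α σ → Entails α (stage α) σ j

-- Closure of validity under the rules

valid-map : ∀ {Γ a b} →
            (∀ α σ → Accepts α ⊩ subst σ a ↓ 1 → Accepts α ⊩ subst σ b ↓ 1) →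
            Valid (Γ ⊢ a) → Valid (Γ ⊢ b)
valid-map f (valid s h) = valid s λ α σ hs → f (s α) σ <$> h α σ hs

valid-map₂ : ∀ {Γ a b c} →
             (∀ α σ → Accepts α ⊩ subst σ a ↓ 1 → Accepts α ⊩ subst σ b ↓ 1 →
              Accepts α ⊩ subst σ c ↓ 1) →
             Valid (Γ ⊢ a) → Valid (Γ ⊢ b) → Valid (Γ ⊢ c)
valid-map₂ f (valid s h) (valid t k) = valid (λ α → s α ⊔ t α) λ α σ hs → do
  d ← h α σ hs
  e ← k α σ hs
  return (f _ σ (↓-mono (⊔-upperˡ (s α) (t α)) d) (↓-mono (⊔-upperʳ (s α) (t α)) e))

valid-cut : ∀ {Γ a c} → Valid (Γ ⊢ a) → Valid (a ∷ Γ ⊢ c) → Valid (Γ ⊢ c)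
-- The second premise is entered at a stage where both the old hypotheses and the cut formula are
-- true.
valid-cut {Γ} (valid s h) (valid t k) = valid (λ α → t (α ⊔ s α)) λ α σ hs →
  k (α ⊔ s α) σ
    (⊨-mono {s α} {α ⊔ s α} (⊔-upperʳ α (s α)) (h α σ hs) ∷
     ⊨ᶜ-mono {α} {α ⊔ s α} σ Γ (⊔-upperˡ α (s α)) hs)

valid-inst : ∀ {Γ c} i s → Valid (Γ ⊢ c) → Valid (map ([ i ↦ s ]_) Γ ⊢ [ i ↦ s ] c)
valid-inst {Γ} {c} i s (valid t h) = valid t λ α σ hs →
  transport (t α ⊨_↓ 1) (sym (subst-[↦] σ i s c))
    (h α (σ [ i ≔ subst σ s ])
      (All.map (λ {g} → transport (α ⊨_↓ 1) (subst-[↦] σ i s g)) (All.map⁻ hs)))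

valid-∨-elim : ∀ {Γ a b c} → Valid (Γ ⊢ a ∨ᵗ b) → Valid (a ∷ Γ ⊢ c) → Valid (b ∷ Γ ⊢ c) →
               Valid (Γ ⊢ c)
valid-∨-elim {Γ} (valid s h) (valid t k) (valid u l) =
  valid (λ α → t (α ⊔ s α) ⊔ u (α ⊔ s α)) λ α σ hs →
    let γ   = α ⊔ s α
        hs′ = ⊨ᶜ-mono {α} {γ} σ Γ (⊔-upperˡ α (s α)) hs
    in h α σ hs >>= λ where
      (↓-∨₁ˡ d) → ⊨-mono {t γ} {t γ ⊔ u γ} (⊔-upperˡ (t γ) (u γ))
                    (k γ σ (return (↓-mono (⊔-upperʳ α (s α)) d) ∷ hs′))
      (↓-∨₁ʳ d) → ⊨-mono {u γ} {t γ ⊔ u γ} (⊔-upperʳ (t γ) (u γ))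
                    (l γ σ (return (↓-mono (⊔-upperʳ α (s α)) d) ∷ hs′))

valid-=-subst : ∀ {Γ a b} i p → Valid (Γ ⊢ a =ᵗ b) → Valid (Γ ⊢ [ i ↦ a ] p) →
                Valid (Γ ⊢ [ i ↦ b ] p)
valid-=-subst {a = a} {b} i p (valid s h) (valid t k) =
  valid (λ α → after (s α) (t α)) λ α σ hs → do
    ↓-= d e ← h α σ hs
    f ← k α σ hs
    transport (after (s α) (t α) ⊨_↓ 1) (sym (subst-[↦] σ i b p))
      (↓-≈ (s α) (t α) (≈-≔ (s α) σ i (return d) (return e) p)
        (transport (Accepts (t α) ⊩_↓ 1) (subst-[↦] σ i a p) f))

-- Induction on numerals yields a stage for each `n`. Which `n` is the value of `a` depends on `σ`,
-- so the supremum over all `n` is taken; replacement then passes from `num n` to `a`.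
valid-induction : ∀ {Γ a c} i → All (λ g → ¬ (i ∈fv g)) Γ →
                  Valid (Γ ⊢ [ i ↦ 𝟎 ] c) →
                  Valid (var i 𝖭 ∷ c ∷ Γ ⊢ [ i ↦ 𝐒 (var i) ] c) →
                  Valid (Γ ⊢ a 𝖭) → Valid (Γ ⊢ [ i ↦ a ] c)
valid-induction {Γ} {a} {c} i fresh (valid s h) (valid t k) (valid u l) =
  valid (λ α → ⋃ λ n → after (u α) (iterate α n)) λ α σ hs → do
    ↓-= {n = n} d _ ← l α σ hs
    e ← reach α σ hs n
    transport (⋃ (λ n → after (u α) (iterate α n)) ⊨_↓ 1) (sym (subst-[↦] σ i a c))
      (⊨-mono {after (u α) (iterate α n)} {⋃ λ n → after (u α) (iterate α n)}
        (⋃-upper (λ n → after (u α) (iterate α n)) n)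
        (↓-≈ (u α) (iterate α n) (≈-≔ (u α) σ i (return (↓-num n)) (return d) c) e))
  where
  iterate : Stage → ℕ → Stage
  iterate α zero    = s α
  iterate α (suc n) = t (α ⊔ iterate α n)

  fresh-context : ∀ α σ n → α , σ ⊨ Γ → α , σ [ i ≔ num n ] ⊨ Γ
  fresh-context α σ n hs = All.zipWith
    (λ {g} (i∉g , d) → transport (α ⊨_↓ 1) (sym (subst-fresh σ (num n) g i∉g)) d) (fresh , hs)

  successor : ∀ σ n → subst (σ [ i ≔ num n ]) ([ i ↦ 𝐒 (var i) ] c) ≡
                      subst (σ [ i ≔ num (suc n) ]) c
  successor σ n = begin
    subst (σ [ i ≔ num n ]) ([ i ↦ 𝐒 (var i) ] c)
      ≡⟨ subst-[↦] (σ [ i ≔ num n ]) i (𝐒 (var i)) c ⟩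
    subst (σ [ i ≔ num n ] [ i ≔ 𝐒 ((σ [ i ≔ num n ]) i) ]) c
      ≡⟨ cong (λ m → subst (σ [ i ≔ num n ] [ i ≔ 𝐒 m ]) c) (≔-same σ i (num n)) ⟩
    subst (σ [ i ≔ num n ] [ i ≔ num (suc n) ]) c
      ≡⟨ subst-cong (≔-overwrite σ i (num n) (num (suc n))) c ⟩
    subst (σ [ i ≔ num (suc n) ]) c ∎

  reach : ∀ α σ → α , σ ⊨ Γ → ∀ n → iterate α n ⊨ subst (σ [ i ≔ num n ]) c ↓ 1
  reach α σ hs zero = transport (s α ⊨_↓ 1) (subst-[↦] σ i 𝟎 c) (h α σ hs)
  reach α σ hs (suc n) = transport (iterate α (suc n) ⊨_↓ 1) (successor σ n)
    (k γ (σ [ i ≔ num n ])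
      (transport (λ m → γ ⊨ m 𝖭 ↓ 1) (sym (≔-same σ i (num n))) (return (↓-= (↓-num n) (↓-num n))) ∷
       ⊨-mono {iterate α n} {γ} (⊔-upperʳ α (iterate α n)) (reach α σ hs n) ∷
       fresh-context γ σ n (⊨ᶜ-mono {α} {γ} σ Γ (⊔-upperˡ α (iterate α n)) hs)))
    where γ = α ⊔ iterate α n

-- The recursor unfolds at the numeral `k` that `m` evaluates to; replacement carries the value of
-- the right-hand side from `m` over to `num k`.
valid-ℛ-step : ∀ {Γ g h m} → Valid (Γ ⊢ m 𝖭) →
               Valid (Γ ⊢ (h · m · (ℛ · g · h · m)) 𝖭) →
               Valid (Γ ⊢ ℛ · g · h · 𝐒 m =ᵗ h · m · (ℛ · g · h · m))
valid-ℛ-step {g = g} {h} {m} (valid s p) (valid t q) =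
  valid (λ α → γ α ⊔ t α) λ α σ hs → do
    ↓-= {n = k} d _ ← p α σ hs
    ↓-= e _ ← q α σ hs
    let m≈k = base (return d) (return (↓-num k))
        g≈g = ≈-refl (s α) (subst σ g)
        h≈h = ≈-refl (s α) (subst σ h)
    e′ ← ↓-≈ (s α) (t α) (h≈h ≈· m≈k ≈· (≈ℛ ≈· g≈g ≈· h≈h ≈· m≈k)) e
    let s≼ = λ {f} → ⊔-upperˡ (γ α) (t α) {f} ∘ ⊔-upperʳ (after (s α) (t α)) (s α)
        a≼ = λ {f} → ⊔-upperˡ (γ α) (t α) {f} ∘ ⊔-upperˡ (after (s α) (t α)) (s α)
    return (↓-= (↓-⟶ (⟶-ℛS (↓-𝐒 (↓-mono s≼ d))) (↓-mono a≼ e′))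
                (↓-mono (⊔-upperʳ (γ α) (t α)) e))
  where
  γ : Stage → Stage
  γ α = after (s α) (t α) ⊔ s α

valid-∀-intro : ∀ {Γ f} → Valid (var 0 𝖭 ∷ map ↑ Γ ⊢ ↑ f · var 0) → Valid (Γ ⊢ 𝒜 · f)
valid-∀-intro {Γ} {f} (valid s h) = valid (λ α → next (s α)) λ α σ hs →
  return (↓-𝒜₁ (tt , λ k →
    transport (λ g → s α ⊨ g · num k ↓ 1) (subst-•-↑ (num k) σ f)
      (h α (num k • σ) (return (↓-= (↓-num k) (↓-num k)) ∷ ⊨ᶜ-↑ α (num k) σ Γ hs))))

valid-∀-elim : ∀ {Γ f a} → Valid (Γ ⊢ 𝒜 · f) → Valid (Γ ⊢ a 𝖭) → Valid (Γ ⊢ f · a)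
valid-∀-elim {f = f} (valid s h) (valid t k) =
  valid (λ α → after (t α) (down (s α))) λ α σ hs → do
    ↓-= {n = n} d _ ← k α σ hs
    h α σ hs >>= λ where
      (↓-⟶ (⟶-app ()) _)
      (↓-𝒜₁ p) → do
        e ← Accepts-down (s α) p n
        ↓-≈ (t α) (down (s α))
          (≈-refl (t α) (subst σ f) ≈· base (return (↓-num n)) (return d)) e

valid-¬∀-intro : ∀ {Γ f a} → Valid (Γ ⊢ ¬ᵗ (f · a)) → Valid (Γ ⊢ a 𝖭) → Valid (Γ ⊢ ¬ᵗ (𝒜 · f))
valid-¬∀-intro {f = f} (valid s h) (valid t k) =
  valid (λ α → after (t α) (s α)) λ α σ hs → do
    ↓-= {n = n} d _ ← k α σ hs
    ↓-¬₀ e ← h α σ hs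
    e′ ← ↓-≈ (t α) (s α) (≈-refl (t α) (subst σ f) ≈· base (return d) (return (↓-num n))) e
    return (↓-¬₀ (↓-𝒜₀ n e′))

valid-¬∀-elim : ∀ {Γ f c} → Valid (Γ ⊢ ¬ᵗ (𝒜 · f)) →
                Valid (var 0 𝖭 ∷ ¬ᵗ (↑ f · var 0) ∷ map ↑ Γ ⊢ ↑ c) → Valid (Γ ⊢ c)
valid-¬∀-elim {Γ} {f} {c} (valid s h) (valid t k) = valid (λ α → t (α ⊔ s α)) λ α σ hs →
  let γ = α ⊔ s α in h α σ hs >>= λ where
    (↓-¬₀ (↓-⟶ (⟶-app ()) _))
    -- A false quantification supplies an actual refuting numeral, which instantiates the bound
    -- variable.
    (↓-¬₀ (↓-𝒜₀ n d)) → transport (t γ ⊨_↓ 1) (subst-•-↑ (num n) σ c)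
      (k γ (num n • σ)
        (return (↓-= (↓-num n) (↓-num n)) ∷
         return (↓-¬₀ (transport (λ g → Accepts γ ⊩ g · num n ↓ 0) (sym (subst-•-↑ (num n) σ f))
                        (↓-mono (⊔-upperʳ α (s α)) d))) ∷
         ⊨ᶜ-↑ γ (num n) σ Γ (⊨ᶜ-mono {α} {γ} σ Γ (⊔-upperˡ α (s α)) hs)))

𝖡-inversion : ∀ {P t} → P ⊩ t 𝖡 ↓ 1 → (P ⊩ t ↓ 1) ⊎ (P ⊩ t ↓ 0)
𝖡-inversion (↓-∨₁ˡ d)        = inj₁ d
𝖡-inversion (↓-∨₁ʳ (↓-¬₀ d)) = inj₂ d

valid-ATI : ∀ {Γ u} → Valid (Γ ⊢ 𝒜 · ƛ ((↑ u · var 0) 𝖡)) → Valid (Γ ⊢ (𝒜 · u) 𝖡)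
valid-ATI {u = u} (valid s h) = valid (λ α → γ α ⊔ next (γ α)) λ α σ hs →
  h α σ hs >>= λ where
    (↓-⟶ (⟶-app ()) _)
    -- The goal is a double negation, so the case split on a false instance is available
    -- constructively.
    (↓-𝒜₁ p) → ¬¬-excluded-middle {A = ∃[ k ] (Accepts (γ α) ⊩ subst σ u · num k ↓ 0)} >>= λ where
      (yes (k , d)) → return (↓-∨₁ʳ (↓-¬₀ (↓-𝒜₀ k (↓-mono (⊔-upperˡ (γ α) (next (γ α))) d))))
      -- Without a false instance, every decided instance is true at the one stage `γ α`, so the
      -- quantification is accepted one level up.
      (no ∄k) → return (↓-∨₁ˡ (↓-𝒜₁ (⊔-upperʳ (γ α) (next (γ α)) (tt , λ k →
        decide α σ p k >>= λ where
          (inj₁ d) → return d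
          (inj₂ d) → contradiction (k , d) ∄k))))
  where
  γ : Stage → Stage
  γ α = down (s α)

  instance-eq : ∀ σ k → (subst (extₛ σ) (↑ u)) ⟨ num k ⟩ ≡ subst σ u
  instance-eq σ k = trans (cong _⟨ num k ⟩ (subst-extₛ-↑ σ u)) (↑-⟨⟩ (subst σ u) (num k))

  decide : ∀ α σ → Accepts (s α) (subst σ (ƛ ((↑ u · var 0) 𝖡))) → ∀ k →
           ¬ ¬ ((Accepts (γ α) ⊩ subst σ u · num k ↓ 1) ⊎ (Accepts (γ α) ⊩ subst σ u · num k ↓ 0))
  decide α σ p k = Accepts-down (s α) p k >>= λ where
    (↓-⟶ ⟶-β d) → return (𝖡-inversion
      (transport (λ v → Accepts (γ α) ⊩ (v · num k) 𝖡 ↓ 1) (instance-eq σ k) d))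

valid-RGA : ∀ {ps j} → RGA ps j → All Valid ps → Valid j
valid-RGA hyp [] = valid id λ { α σ (h ∷ _) → h }
valid-RGA weaken (valid s h ∷ []) = valid s λ { α σ (_ ∷ hs) → h α σ hs }
valid-RGA cut (v ∷ w ∷ []) = valid-cut v w
valid-RGA (inst i s) (v ∷ []) = valid-inst i s v
valid-RGA true⁺ (v ∷ []) = valid-map (λ α σ d → ↓-= d (↓-num 1)) v
valid-RGA true⁻ (v ∷ []) = valid-map (λ { α σ (↓-= d (↓-𝐒 ↓-𝟎)) → d }) v
valid-RGA false⁺ (v ∷ []) = valid-map (λ { α σ (↓-¬₀ d) → ↓-= d ↓-𝟎 }) v
valid-RGA false⁻ (v ∷ []) = valid-map (λ { α σ (↓-= d ↓-𝟎) → ↓-¬₀ d }) v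
valid-RGA explosion (v ∷ w ∷ []) =
  valid-map₂ (λ { α σ (↓-¬₀ d) e → contradiction (↓-functional α α d e) λ () }) v w
valid-RGA ¬¬⁺ (v ∷ []) = valid-map (λ α σ d → ↓-¬₀ (↓-¬₁ d)) v
valid-RGA ¬¬⁻ (v ∷ []) = valid-map (λ { α σ (↓-¬₀ (↓-¬₁ d)) → d }) v
valid-RGA ∨-introˡ (v ∷ []) = valid-map (λ α σ → ↓-∨₁ˡ) v
valid-RGA ∨-introʳ (v ∷ []) = valid-map (λ α σ → ↓-∨₁ʳ) v
valid-RGA ¬∨-intro (v ∷ w ∷ []) =
  valid-map₂ (λ { α σ (↓-¬₀ d) (↓-¬₀ e) → ↓-¬₀ (↓-∨₀ d e) }) v w
valid-RGA ∨-elim (v ∷ w ∷ x ∷ []) = valid-∨-elim v w x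
valid-RGA ¬∨-elimˡ (v ∷ []) = valid-map (λ { α σ (↓-¬₀ (↓-∨₀ d e)) → ↓-¬₀ d }) v
valid-RGA ¬∨-elimʳ (v ∷ []) = valid-map (λ { α σ (↓-¬₀ (↓-∨₀ d e)) → ↓-¬₀ e }) v
valid-RGA 𝖭-def⁺ (v ∷ []) = v
valid-RGA 𝖭-def⁻ (v ∷ []) = v
valid-RGA =-sym (v ∷ []) = valid-map (λ { α σ (↓-= d e) → ↓-= e d }) v
valid-RGA (=-subst i p) (v ∷ w ∷ []) = valid-=-subst i p v w
valid-RGA ≠-sym (v ∷ []) = valid-map (λ { α σ (↓-¬₀ (↓-≠ d e m≢n)) → ↓-¬₀ (↓-≠ e d (m≢n ∘ sym)) }) v
valid-RGA =-bool (v ∷ w ∷ []) = valid-map₂ (λ { α σ (↓-= d _) (↓-= e _) → compare d e }) v w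
  where
  compare : ∀ {P a b m n} → P ⊩ a ↓ m → P ⊩ b ↓ n → P ⊩ (a =ᵗ b) 𝖡 ↓ 1
  compare {m = m} {n} d e with m ≟ n
  ... | yes refl = ↓-∨₁ˡ (↓-= d e)
  ... | no m≢n   = ↓-∨₁ʳ (↓-¬₀ (↓-≠ d e m≢n))
valid-RGA =-bool⁻¹ (v ∷ []) = valid-map
  (λ { α σ (↓-∨₁ˡ (↓-= d e))          → both d e
     ; α σ (↓-∨₁ʳ (↓-¬₀ (↓-≠ d e _))) → both d e }) v
  where
  both : ∀ {P a b m n} → P ⊩ a ↓ m → P ⊩ b ↓ n → P ⊩ (a 𝖭) ∧ᵗ (b 𝖭) ↓ 1
  both d e = ↓-¬₀ (↓-∨₀ (↓-¬₁ (↓-= d d)) (↓-¬₁ (↓-= e e)))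
valid-RGA 𝟎-nat [] = valid id λ α σ hs → return (↓-= ↓-𝟎 ↓-𝟎)
valid-RGA 𝐒-nat⁺ (v ∷ []) = valid-map (λ { α σ (↓-= d e) → ↓-= (↓-𝐒 d) (↓-𝐒 e) }) v
valid-RGA 𝐒-nat⁻ (v ∷ []) = valid-map (λ { α σ (↓-= (↓-𝐒 d) (↓-𝐒 e)) → ↓-= d e }) v
valid-RGA 𝐒≠𝟎 (v ∷ []) = valid-map (λ { α σ (↓-= d _) → ↓-¬₀ (↓-≠ (↓-𝐒 d) ↓-𝟎 λ ()) }) v
valid-RGA 𝐒-≠⁺ (v ∷ []) =
  valid-map (λ { α σ (↓-¬₀ (↓-≠ d e m≢n)) → ↓-¬₀ (↓-≠ (↓-𝐒 d) (↓-𝐒 e) (m≢n ∘ suc-injective)) }) v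
valid-RGA 𝐒-≠⁻ (v ∷ []) =
  valid-map (λ { α σ (↓-¬₀ (↓-≠ (↓-𝐒 d) (↓-𝐒 e) m≢n)) → ↓-¬₀ (↓-≠ d e (m≢n ∘ cong suc)) }) v
valid-RGA 𝐒-inj (v ∷ []) = valid-map (λ { α σ (↓-= (↓-𝐒 d) (↓-𝐒 e)) → ↓-= d e }) v
valid-RGA ⊥-nat (v ∷ []) = valid-map (λ { α σ (↓-= (↓-⟶ () _) _) }) v
valid-RGA (induction i fresh) (v ∷ w ∷ x ∷ []) = valid-induction i fresh v w x
valid-RGA (conv-expand r) (v ∷ []) = valid-map (λ α σ d → ↓-⟶ (▷⇒⟶ (▷-subst σ r)) d) v
valid-RGA (conv-reduce r) (v ∷ []) = valid-map (λ α σ → ↓-reduct α (▷-subst σ r)) v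
valid-RGA (conv-¬ r) (v ∷ []) =
  valid-map (λ { α σ (↓-¬₀ d) → ↓-¬₀ (↓-reduct α (▷-subst σ r) d) }) v
valid-RGA (conv-= r) (v ∷ []) =
  valid-map (λ { α σ (↓-= d e) → ↓-= (↓-⟶ (▷⇒⟶ (▷-subst σ r)) d) e }) v
valid-RGA ℛ-step (v ∷ w ∷ []) = valid-ℛ-step v w
valid-RGA ∀-intro (v ∷ []) = valid-∀-intro v
valid-RGA ∀-elim (v ∷ w ∷ []) = valid-∀-elim v w
valid-RGA ¬∀-intro (v ∷ w ∷ []) = valid-¬∀-intro v w
valid-RGA ¬∀-elim (v ∷ w ∷ []) = valid-¬∀-elim v w

-- Soundness of whole proofs

valid-OGA : ∀ {ps j} → OGA ps j → All Valid ps → Valid j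
valid-OGA (rga r) vs       = valid-RGA r vs
valid-OGA ATI     (v ∷ []) = valid-ATI v

valid-proof : ∀ {π} → Proof OGA π → All Valid π
valid-proof []            = []
valid-proof (step π r ps) = valid-OGA r (All.map (All.lookup (valid-proof π)) ps) ∷ valid-proof π
valid-proof (same π p Γ∼Δ) with valid s h ← All.lookup (valid-proof π) p =
  valid s (λ α σ hs → h α σ (All.tabulate (All.lookup hs ∘ Equivalence.to Γ∼Δ))) ∷ valid-proof π

soundness : ∀ {j} → Derivable OGA j → Valid j
soundness (_ , π , p) = All.lookup (valid-proof π) p

-- Stages for ω-true sentences

⇓⇒↓ : ∀ {t n} → t ⇓ n → ∃[ α ] (Accepts α ⊩ t ↓ n)
⇓⇒↓-both : ∀ {t u m n} → t ⇓ m → u ⇓ n → ∃[ α ] (Accepts α ⊩ t ↓ m) × (Accepts α ⊩ u ↓ n)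

-- The supremum of the empty family accepts no quantification at all.
⇓⇒↓ ⇓-𝟎 = ⋃ {⊥} (λ ()) , ↓-𝟎
⇓⇒↓ (⇓-𝐒 d) = let α , d′ = ⇓⇒↓ d in α , ↓-𝐒 d′
⇓⇒↓ (⇓-= d e refl) = let α , d′ , e′ = ⇓⇒↓-both d e in α , ↓-= d′ e′
⇓⇒↓ (⇓-≠ d e m≢n) = let α , d′ , e′ = ⇓⇒↓-both d e in α , ↓-≠ d′ e′ m≢n
⇓⇒↓ (⇓-¬₁ d) = let α , d′ = ⇓⇒↓ d in α , ↓-¬₁ d′
⇓⇒↓ (⇓-¬₀ d) = let α , d′ = ⇓⇒↓ d in α , ↓-¬₀ d′
⇓⇒↓ (⇓-∨₁ˡ d) = let α , d′ = ⇓⇒↓ d in α , ↓-∨₁ˡ d′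
⇓⇒↓ (⇓-∨₁ʳ d) = let α , d′ = ⇓⇒↓ d in α , ↓-∨₁ʳ d′
⇓⇒↓ (⇓-∨₀ d e) = let α , d′ , e′ = ⇓⇒↓-both d e in α , ↓-∨₀ d′ e′
⇓⇒↓ (⇓-β ss d) = let α , d′ = ⇓⇒↓ d in α , ↓-⟶ (⟶-·* ss ⟶-β) d′
⇓⇒↓ (⇓-ℛ0 ss d e) =
  let α , d′ , e′ = ⇓⇒↓-both d e in α , ↓-⟶ (⟶-·* ss (⟶-ℛ0 d′)) e′
⇓⇒↓ (⇓-ℛS ss d e) =
  let α , d′ , e′ = ⇓⇒↓-both d e in α , ↓-⟶ (⟶-·* ss (⟶-ℛS d′)) e′
⇓⇒↓ (⇓-𝒜₁ d) =
  let α = λ k → proj₁ (⇓⇒↓ (d k))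
  -- All instances are first brought to the common stage `⋃ α`, as acceptance by its successor
  -- requires.
  in next (⋃ α) , ↓-𝒜₁ (tt , λ k → return (↓-mono (⋃-upper α k) (proj₂ (⇓⇒↓ (d k)))))
⇓⇒↓ (⇓-𝒜₀ k d) = let α , d′ = ⇓⇒↓ d in α , ↓-𝒜₀ k d′

⇓⇒↓-both d e =
  let α , d′ = ⇓⇒↓ d
      β , e′ = ⇓⇒↓ e
  in α ⊔ β , ↓-mono (⊔-upperˡ α β) d′ , ↓-mono (⊔-upperʳ α β) e′

ω-true-stage : ∀ {E} → All ω-True E → ∃[ α ] (α , var ⊨ E)
ω-true-stage [] = ⋃ {⊥} (λ ()) , []
ω-true-stage (_∷_ {t} {E} (_ , t⇓1) ts) =
  let α , d  = ⇓⇒↓ t⇓1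
      β , ds = ω-true-stage ts
  in α ⊔ β ,
     transport (α ⊔ β ⊨_↓ 1) (sym (subst-var t)) (return (↓-mono (⊔-upperˡ α β) d)) ∷
     ⊨ᶜ-mono {β} {α ⊔ β} var E (⊔-upperʳ α β) ds

theorem6p8 : (E : List Term) → All ω-True E →
    ¬ (∃[ c ] (Derivable OGA (E ⊢ c) × Derivable OGA (E ⊢ ¬ᵗ c)))
theorem6p8 E true (c , ⊢c , ⊢¬c)
  with α , hs ← ω-true-stage true
  with valid s h ← soundness ⊢c
  with valid t k ← soundness ⊢¬c =
  -- The goal is absurdity, so both double negations can be opened: `c` would have the values 1 and
  -- 0, at two possibly different stages.
  h α var hs λ d → k α var hs λ where
    (↓-¬₀ e) → contradiction (↓-functional (s α) (t α) d e) λ ()
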